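{- Let $n \ge k \ge 2$ be integers. If $n$ is even, then $$\frac{n-2}{k-1}+\frac{n}{2(k-1)^2} \le A_p(n,k) \le A_c(n,k) \le \Big\lceil \frac{n-1}{k-1} \Big\rceil+\Big\lceil \frac{n-1}{(k-1)^2}\Big\rceil.$$ If $n$ is odd, then $$\frac{n-5}{k-1}+\frac{n-k}{2(k-1)^2}\le A_p(n,k) \le A_c(n,k) \le \Big\lceil \frac{n-1}{k-1} \Big\rceil + \Big\lceil\frac{n-1}{(k-1)^2}\Big\rceil.$$
   Context: Consider the following adaptive search game between Questioner and Adversary. There are $n$ balls labelled $1,\dots,n$, each colored with one of three colors; the coloring is unknown to Questioner. A query is a $k$-element subset of the balls, chosen adaptively (it may depend on previous answers). The answer to a query is the partition of the queried set into color classes (i.e. which queried balls have the same color as each other), without revealing which color each class has. Adversary may answer arbitrarily as long as there always exists a 3-coloring of all $n$ balls consistent with all answers given so far. A plurality ball is a ball whose color class is strictly larger than every other color class. In the Plurality problem, Questioner must either exhibit a plurality ball or correctly state that none exists, i.e. the answers must determine this for every consistent coloring. $A_p(n,k)$ denotes the number of queries needed in the worst case when both players play optimally (minimum over Questioner strategies of the maximum over Adversary strategies of the number of queries). $A_c(n,k)$ is defined in the same way for the Partition problem, where Questioner's goal is to determine the partition of the balls into color classes (up to permutation of the colors). -}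

module Defs where

open import Data.Nat using (ℕ; zero; suc; _+_; _/_)
open import Data.Fin using (Fin; _≟_)
open import Data.Fin.Subset using (Subset; _∈_; ∣_∣)
open import Data.List using (length; filter; allFin)
open import Data.Product using (Σ; _×_)
open import Data.Sum using (_⊎_)
open import Data.Unit using (⊤)
open import Relation.Nullary using (¬_)
open import Relation.Binary.PropositionalEquality using (_≡_; _≢_)
open import Data.Nat using (_<_)

Coloring : ℕ → Set
Coloring n = Fin n → Fin 3

-- A knowledge state: the set of colourings still consistent with all answers.
State : ℕ → Set₁
State n = Coloring n → Set

SameAnswer : ∀ {n} → Subset n → Coloring n → Coloring n → Set
SameAnswer {n} Q c d = (i j : Fin n) → i ∈ Q → j ∈ Q →
  ((c i ≡ c j → d i ≡ d j) × (d i ≡ d j → c i ≡ c j))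

classSize : ∀ {n} → Coloring n → Fin 3 → ℕ
classSize {n} c x = length (filter (λ i → c i ≟ x) (allFin n))

IsPlurality : ∀ {n} → Coloring n → Fin n → Set
IsPlurality c b = (x : Fin 3) → x ≢ c b → classSize c x < classSize c (c b)

HasPlurality : ∀ {n} → Coloring n → Set
HasPlurality {n} c = Σ (Fin n) (IsPlurality c)

GoalP : ∀ {n} → State n → Set
GoalP {n} S = Σ (Fin n) (λ b → (c : Coloring n) → S c → IsPlurality c b)
            ⊎ ((c : Coloring n) → S c → ¬ HasPlurality c)

GoalC : ∀ {n} → State n → Set
GoalC {n} S = (c d : Coloring n) → S c → S d → (i j : Fin n) → c i ≡ c j → d i ≡ d j

-- Wins G k q S : Questioner, asking k-element queries, can reach goal G from
-- state S within at most q further queries, against every Adversary.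
-- Adversary's answer to query Q is the partition of Q induced by some colouring
-- c still consistent (c ∈ S); the new state keeps the colourings giving the same answer.
Wins : ∀ {n} → (State n → Set) → ℕ → ℕ → State n → Set
Wins G k zero S = G S
Wins {n} G k (suc q) S = G S ⊎ Σ (Subset n) (λ Q → (∣ Q ∣ ≡ k) ×
  ((c : Coloring n) → S c → Wins G k q (λ d → S d × SameAnswer Q c d)))

Initial : ∀ {n} → State n
Initial _ = ⊤

-- ⌈ a / b ⌉ for b ≥ 1 (value at b = 0 is irrelevant; set to 0)
ceilDiv : ℕ → ℕ → ℕ
ceilDiv a zero = 0
ceilDiv a (suc b) = (a + b) / suc b

{-# OPTIONS --safe #-}

-- Upper bound: compare a fixed ball a with all others, K = k − 1 at a time. This leaves one unknown
-- bit per query, namely which of the two colours other than that of a is which; K of these bits are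
-- resolved by a single query on representatives together with one ball of another colour than a.
--
-- Lower bound: Adversary answers according to a colouring with classes of sizes m, m and ε = n mod 2,
-- but still exchanges colours among balls that were not queried so far, so that as many queries as
-- possible are split: they meet both large classes and avoid the third. Every split query exhausts at
-- most K balls of each large class, which forces about m / K split queries. At the end, consider the
-- components spanned by the monochromatic parts of the queries, where a query meeting the small class
-- is joined into one component. Two (three, if n is odd) components of the same large colour would
-- allow one of them to be recoloured by the third colour, creating a plurality. So boundedly many
-- components remain, while a split query reduces their number by K − 1 only and any other one by K.
module Submission where

open import Defs
import Algebra.Properties.CommutativeMonoid.Sum as Sum
open import Data.Bool using (Bool; true; false)
open import Data.Fin using (Fin; zero; suc; _≟_)
open import Data.Fin.Patterns using (0F; 1F; 2F)
open import Data.Fin.Permutation using (transpose; _⟨$⟩ʳ_)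
open import Data.Fin.Properties using (any?; all?)
open import Data.Fin.Subset using (Subset; _∈_; _∉_; _⊆_; ∣_∣; ⁅_⁆; _∪_; ⊥; inside; outside)
open import Data.Fin.Subset.Properties
  using (_∈?_; x∈p∪q⁺; x∈p∪q⁻; ∣p∣≤n; x∈⁅x⁆; ∣⁅x⁆∣≡1; ∣⊥∣≡0; ∉⊥)
open import Data.List
  using (List; []; _∷_; length; filter; allFin; tabulate; map; foldr; take; drop)
import Data.List.Membership.Propositional as List
open import Data.List.Membership.Propositional.Properties
  using (∈-++⁻; ∈-map⁺; ∈-tabulate⁺; ∈-filter⁺; ∈-allFin)
open import Data.List.Properties
  using (length-map; length-tabulate; length-take; length-drop; take++drop≡id)
open import Data.List.Relation.Unary.All as All using (All; []; _∷_)
open import Data.List.Relation.Unary.All.Properties as All using (all-filter)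
open import Data.List.Relation.Unary.Any as Any using (Any; here; there)
open import Data.List.Relation.Unary.Any.Properties as Any using ()
open import Data.Nat using (ℕ; zero; suc; _+_; _*_; _∸_; _^_; _/_; _%_; ⌊_/2⌋; _≤_; _<_; z≤n; s≤s)
open import Data.Nat.DivMod using (m≡m%n+[m/n]*n; m%n<n; m<n*o⇒m/o<n)
open import Data.Nat.Properties hiding (_≟_)
open import Data.Nat.Tactic.RingSolver using (solve-∀)
open import Data.Product using (∃; ∃-syntax; _×_; _,_; proj₁; proj₂)
open import Data.Sum using (_⊎_; inj₁; inj₂; [_,_]′)
open import Data.Unit using (tt)
open import Data.Vec using ([]; _∷_)
import Data.Vec as Vec
open import Function using (_∘_; id)
open import Level using (0ℓ)
open import Relation.Binary.PropositionalEquality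
  using (_≡_; _≢_; refl; sym; trans; cong; cong₂; subst)
open import Relation.Nullary using (¬_; Dec; yes; no; contradiction)
open import Relation.Nullary.Decidable using (_×-dec_; _⊎-dec_; _→-dec_; ¬?; does; from-yes; toSum)
open import Relation.Unary using (Pred; Decidable)

open Sum +-0-commutativeMonoid using (sum; ∑-distrib-+; sum-permute)

-- Counting in decidable subsets of a finite set

bit : Bool → ℕ
bit true  = 1
bit false = 0

count : ∀ {n} {P : Pred (Fin n) 0ℓ} → Decidable P → ℕ
count P? = sum (λ i → bit (does (P? i)))

sum-mono-≤ : ∀ {n} {f g : Fin n → ℕ} → (∀ i → f i ≤ g i) → sum f ≤ sum g
sum-mono-≤ {zero}  h = z≤n
sum-mono-≤ {suc n} h = +-mono-≤ (h zero) (sum-mono-≤ (h ∘ suc))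

length-filter-tabulate : ∀ {n} {A : Set} {P : Pred A 0ℓ} (P? : Decidable P) (f : Fin n → A) →
  length (filter P? (tabulate f)) ≡ count (P? ∘ f)
length-filter-tabulate {zero}  P? f = refl
length-filter-tabulate {suc n} P? f with does (P? (f zero))
... | true  = cong suc (length-filter-tabulate P? (f ∘ suc))
... | false = length-filter-tabulate P? (f ∘ suc)

length-filter-allFin : ∀ {n} {P : Pred (Fin n) 0ℓ} (P? : Decidable P) →
  length (filter P? (allFin n)) ≡ count P?
length-filter-allFin P? = length-filter-tabulate P? id

∣p∣≡count : ∀ {n} (p : Subset n) → ∣ p ∣ ≡ count (_∈? p)
∣p∣≡count []            = refl
∣p∣≡count (outside ∷ p) = ∣p∣≡count p
∣p∣≡count (inside ∷ p)  = cong suc (∣p∣≡count p)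

count-all : ∀ {n} {P : Pred (Fin n) 0ℓ} (P? : Decidable P) → (∀ i → P i) → count P? ≡ n
count-all {zero}  P? h = refl
count-all {suc n} P? h with P? zero
... | yes _ = cong suc (count-all (P? ∘ suc) (h ∘ suc))
... | no ¬p = contradiction (h zero) ¬p

count-none : ∀ {n} {P : Pred (Fin n) 0ℓ} (P? : Decidable P) → (∀ i → ¬ P i) → count P? ≡ 0
count-none {zero}  P? h = refl
count-none {suc n} P? h with P? zero
... | yes p = contradiction p (h zero)
... | no _  = count-none (P? ∘ suc) (h ∘ suc)

module _ {n : ℕ} {P Q : Pred (Fin n) 0ℓ} (P? : Decidable P) (Q? : Decidable Q) where

  count-mono : (∀ i → P i → Q i) → count P? ≤ count Q?
  count-mono h = sum-mono-≤ pointwise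
    where
    pointwise : ∀ i → bit (does (P? i)) ≤ bit (does (Q? i))
    pointwise i with P? i | Q? i
    ... | yes p | yes _ = ≤-refl
    ... | yes p | no ¬q = contradiction (h i p) ¬q
    ... | no _  | _     = z≤n

  module _ {R : Pred (Fin n) 0ℓ} (R? : Decidable R) where

    count-cover : (∀ i → R i → P i ⊎ Q i) → count R? ≤ count P? + count Q?
    count-cover h = ≤-trans (sum-mono-≤ pointwise) (≤-reflexive (∑-distrib-+ (bit ∘ does ∘ P?) (bit ∘ does ∘ Q?)))
      where
      pointwise : ∀ i → bit (does (R? i)) ≤ bit (does (P? i)) + bit (does (Q? i))
      pointwise i with R? i | P? i | Q? i
      ... | no _  | _     | _     = z≤n
      ... | yes _ | yes _ | _     = s≤s z≤n
      ... | yes _ | no _  | yes _ = ≤-refl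
      ... | yes r | no ¬p | no ¬q = contradiction (h i r) [ ¬p , ¬q ]′

    count-disjoint : (∀ i → P i → R i) → (∀ i → Q i → R i) → (∀ i → P i → ¬ Q i) →
      count P? + count Q? ≤ count R?
    count-disjoint P⊆R Q⊆R P∩Q = ≤-trans (≤-reflexive (sym (∑-distrib-+ (bit ∘ does ∘ P?) (bit ∘ does ∘ Q?)))) (sum-mono-≤ pointwise)
      where
      pointwise : ∀ i → bit (does (P? i)) + bit (does (Q? i)) ≤ bit (does (R? i))
      pointwise i with P? i | Q? i | R? i
      ... | yes p | yes q | _     = contradiction q (P∩Q i p)
      ... | yes p | no _  | yes _ = ≤-refl
      ... | yes p | no _  | no ¬r = contradiction (P⊆R i p) ¬r
      ... | no _  | yes q | yes _ = ≤-refl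
      ... | no _  | yes q | no ¬r = contradiction (Q⊆R i q) ¬r
      ... | no _  | no _  | _     = z≤n

count-≡ : ∀ {n} (x : Fin n) → count (_≟ x) ≡ 1
count-≡ {suc n} zero    = cong suc (count-none {n} (λ i → _≟_ {suc n} (suc i) zero) λ _ ())
count-≡ {suc n} (suc x) = ≤-antisym
  (≤-trans (count-mono (λ i → suc i ≟ suc x) (_≟ x) λ { i refl → refl }) (≤-reflexive (count-≡ x)))
  (≤-trans (≤-reflexive (sym (count-≡ x))) (count-mono (_≟ x) (λ i → suc i ≟ suc x) λ { i refl → refl }))

count>0⇒∃ : ∀ {n} {P : Pred (Fin n) 0ℓ} (P? : Decidable P) → 0 < count P? → ∃ P
count>0⇒∃ P? 0<P with any? P?
... | yes ∃p = ∃p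
... | no ¬∃p = contradiction (subst (0 <_) (count-none P? λ i p → ¬∃p (i , p)) 0<P) λ ()

∃⇒count>0 : ∀ {n} {P : Pred (Fin n) 0ℓ} (P? : Decidable P) {x} → P x → 0 < count P?
∃⇒count>0 P? {x} px = subst (_≤ count P?) (count-≡ x) (count-mono (_≟ x) P? λ { i refl → px })

count-transpose : ∀ {n} {P : Pred (Fin n) 0ℓ} (P? : Decidable P) (u v : Fin n) →
  count (λ i → P? (transpose u v ⟨$⟩ʳ i)) ≡ count P?
count-transpose P? u v = sym (sum-permute (bit ∘ does ∘ P?) (transpose u v))

classSize≡count : ∀ {n} (c : Coloring n) x → classSize c x ≡ count (λ i → c i ≟ x)
classSize≡count c x = length-filter-allFin (λ i → c i ≟ x)

-- Comparing colourings through the partitions they induce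

Agree : ∀ {n} → Coloring n → Coloring n → Fin n → Fin n → Set
Agree c d i j = (c i ≡ c j → d i ≡ d j) × (d i ≡ d j → c i ≡ c j)

agree-sym : ∀ {n} {c d : Coloring n} {i j} → Agree c d i j → Agree c d j i
agree-sym (f , g) = (sym ∘ f ∘ sym) , (sym ∘ g ∘ sym)

sameAnswer-trans : ∀ {n} {Q : Subset n} {c d e} → SameAnswer Q c d → SameAnswer Q d e → SameAnswer Q c e
sameAnswer-trans cd de i j i∈Q j∈Q =
  (proj₁ (de i j i∈Q j∈Q) ∘ proj₁ (cd i j i∈Q j∈Q)) , (proj₂ (cd i j i∈Q j∈Q) ∘ proj₂ (de i j i∈Q j∈Q))

sameAnswer-sym : ∀ {n} {Q : Subset n} {c d} → SameAnswer Q c d → SameAnswer Q d c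
sameAnswer-sym cd i j i∈Q j∈Q = proj₂ (cd i j i∈Q j∈Q) , proj₁ (cd i j i∈Q j∈Q)

isPlurality-resp : ∀ {n} {c d : Coloring n} {b} → (∀ i j → Agree c d i j) → IsPlurality c b → IsPlurality d b
isPlurality-resp {c = c} {d} {b} c≈d plur x x≢db
  with any? (λ j → d j ≟ x)
... | yes (j , refl) = begin-strict
  classSize d (d j)            ≡⟨ classSize≡count d (d j) ⟩
  count (λ i → d i ≟ d j)      ≤⟨ count-mono (λ i → d i ≟ d j) (λ i → c i ≟ c j) (λ i → proj₂ (c≈d i j)) ⟩
  count (λ i → c i ≟ c j)      ≡⟨ classSize≡count c (c j) ⟨
  classSize c (c j)            <⟨ plur (c j) (λ cj≡cb → x≢db (proj₁ (c≈d j b) cj≡cb)) ⟩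
  classSize c (c b)            ≡⟨ classSize≡count c (c b) ⟩
  count (λ i → c i ≟ c b)      ≤⟨ count-mono (λ i → c i ≟ c b) (λ i → d i ≟ d b) (λ i → proj₁ (c≈d i b)) ⟩
  count (λ i → d i ≟ d b)      ≡⟨ classSize≡count d (d b) ⟨
  classSize d (d b)            ∎
  where open ≤-Reasoning
-- The colour `x` does not occur in `d`, so it has no counterpart in `c`; its empty class is beaten
-- by the class containing `b`.
... | no ∄j = begin-strict
  classSize d x                ≡⟨ classSize≡count d x ⟩
  count (λ i → d i ≟ x)        ≡⟨ count-none (λ i → d i ≟ x) (λ i di≡x → ∄j (i , di≡x)) ⟩
  0                            <⟨ ∃⇒count>0 (λ i → d i ≟ d b) {b} refl ⟩
  count (λ i → d i ≟ d b)      ≡⟨ classSize≡count d (d b) ⟨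
  classSize d (d b)            ∎
  where open ≤-Reasoning

hasPlurality? : ∀ {n} (c : Coloring n) → Dec (HasPlurality c)
hasPlurality? c = any? λ b → all? λ x → ¬? (x ≟ c b) →-dec (classSize c x <? classSize c (c b))

-- All members of `S` induce the same partition, so it suffices to inspect the one supplied by
-- `∃ S`.
goalC⇒goalP : ∀ {n} {S : State n} → ∃ S → GoalC S → GoalP S
goalC⇒goalP {S = S} (c , Sc) goal with hasPlurality? c
... | yes (b , plur) = inj₁ (b , λ d Sd → isPlurality-resp (λ i j → goal c d Sc Sd i j , goal d c Sd Sc i j) plur)
... | no ¬plur       = inj₂ λ d Sd (b , plur) →
  ¬plur (b , isPlurality-resp (λ i j → goal d c Sd Sc i j , goal c d Sc Sd i j) plur)

winsC⇒winsP : ∀ {n k} q {S : State n} → ∃ S → Wins GoalC k q S → Wins GoalP k q S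
winsC⇒winsP zero    ∃S goal                      = goalC⇒goalP ∃S goal
winsC⇒winsP (suc q) ∃S (inj₁ goal)               = inj₁ (goalC⇒goalP ∃S goal)
-- The colouring that gives the answer is consistent with it, so the next state is inhabited as
-- well.
winsC⇒winsP (suc q) ∃S (inj₂ (Q , ∣Q∣≡k , next)) = inj₂ (Q , ∣Q∣≡k , λ c Sc →
  winsC⇒winsP q (c , Sc , λ _ _ _ _ → id , id) (next c Sc))

-- Upper bound: padding queries and asking them in batches

winsC-antitone : ∀ {n k} q {S S′ : State n} → (∀ d → S′ d → S d) → Wins GoalC k q S → Wins GoalC k q S′
winsC-antitone zero    S′⊆S goal = λ c d S′c S′d → goal c d (S′⊆S c S′c) (S′⊆S d S′d)
winsC-antitone (suc q) S′⊆S (inj₁ goal) = inj₁ λ c d S′c S′d → goal c d (S′⊆S c S′c) (S′⊆S d S′d)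
winsC-antitone (suc q) S′⊆S (inj₂ (Q , ∣Q∣≡k , next)) = inj₂ (Q , ∣Q∣≡k , λ c S′c →
  winsC-antitone q (λ d (S′d , same) → S′⊆S d S′d , same) (next c (S′⊆S c S′c)))

-- Queries have exactly `k` elements. A smaller set is padded to that size; its answer can be read
-- off from the answer to the larger set.
∃-superset : ∀ {n} (p : Subset n) k → ∣ p ∣ ≤ k → k ≤ n → ∃[ p′ ] p ⊆ p′ × ∣ p′ ∣ ≡ k
∃-superset []            zero    _   _   = [] , id , refl
∃-superset {suc n} (inside ∷ p)  (suc k) (s≤s ∣p∣≤k) (s≤s k≤n) =
  let p′ , p⊆p′ , ∣p′∣≡k = ∃-superset p k ∣p∣≤k k≤n
  in  inside ∷ p′ , (λ { Vec.here → Vec.here ; (Vec.there x∈p) → Vec.there (p⊆p′ x∈p) }) , cong suc ∣p′∣≡k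
∃-superset {suc n} (outside ∷ p) k ∣p∣≤k k≤1+n with k ≤? n
... | yes k≤n =
  let p′ , p⊆p′ , ∣p′∣≡k = ∃-superset p k ∣p∣≤k k≤n
  in  outside ∷ p′ , (λ { (Vec.there x∈p) → Vec.there (p⊆p′ x∈p) }) , ∣p′∣≡k
-- Here `k` equals `suc n`, so every element has to be taken.
... | no k≰n =
  let p′ , p⊆p′ , ∣p′∣≡n = ∃-superset p n (∣p∣≤n p) ≤-refl
  in  inside ∷ p′ , (λ { (Vec.there x∈p) → Vec.there (p⊆p′ x∈p) }) , trans (cong suc ∣p′∣≡n) (≤-antisym (≰⇒> k≰n) k≤1+n)

fromList : ∀ {n} → List (Fin n) → Subset n
fromList = foldr (λ i p → ⁅ i ⁆ ∪ p) ⊥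

∈-fromList⁺ : ∀ {n} {x : Fin n} {xs} → x List.∈ xs → x ∈ fromList xs
∈-fromList⁺ {xs = x ∷ _} (here refl)  = x∈p∪q⁺ (inj₁ (x∈⁅x⁆ x))
∈-fromList⁺              (there x∈xs) = x∈p∪q⁺ (inj₂ (∈-fromList⁺ x∈xs))

∣p∪q∣≤∣p∣+∣q∣ : ∀ {n} (p q : Subset n) → ∣ p ∪ q ∣ ≤ ∣ p ∣ + ∣ q ∣
∣p∪q∣≤∣p∣+∣q∣ p q rewrite ∣p∣≡count (p ∪ q) | ∣p∣≡count p | ∣p∣≡count q =
  count-cover (_∈? p) (_∈? q) (_∈? (p ∪ q)) λ _ → x∈p∪q⁻ p q

∣fromList∣≤length : ∀ {n} (xs : List (Fin n)) → ∣ fromList xs ∣ ≤ length xs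
∣fromList∣≤length {n} []   = ≤-reflexive (∣⊥∣≡0 n)
∣fromList∣≤length (x ∷ xs) = ≤-trans (∣p∪q∣≤∣p∣+∣q∣ ⁅ x ⁆ (fromList xs))
  (+-mono-≤ (≤-reflexive (∣⁅x⁆∣≡1 x)) (∣fromList∣≤length xs))

AgreeOnAll : ∀ {n} → List (Subset n) → Coloring n → Coloring n → Set
AgreeOnAll Qs c d = All (λ Q → SameAnswer Q c d) Qs

-- Each answer comes from a colouring consistent with the earlier ones, so the last of these
-- colourings realises all answers at once, and a batch may be treated as answered by a single `c`.
-- Padding only shrinks the resulting state.
askAll : ∀ {n k} → k ≤ n → ∀ {S : State n} {q} Qs → All (λ Q → ∣ Q ∣ ≤ k) Qs → ∃ S →
  (∀ c → S c → Wins GoalC k q (λ d → S d × AgreeOnAll Qs c d)) → Wins GoalC k (length Qs + q) S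
askAll k≤n {q = q} [] [] (c , Sc) wins = winsC-antitone q (λ d Sd → Sd , []) (wins c Sc)
askAll {k = k} k≤n {S} {q} (Q ∷ Qs) (∣Q∣≤k ∷ sizes) ∃S wins =
  let Q′ , Q⊆Q′ , ∣Q′∣≡k = ∃-superset Q k ∣Q∣≤k k≤n
  in  inj₂ (Q′ , ∣Q′∣≡k , λ c Sc → askAll k≤n Qs sizes (c , Sc , λ _ _ _ _ → id , id) λ c′ (Sc′ , cc′) →
        winsC-antitone q
          (λ d ((Sd , cd) , c′d) → Sd ,
            (λ i j i∈Q j∈Q → sameAnswer-trans {Q = Q′} (sameAnswer-sym {Q = Q′} cc′) cd i j (Q⊆Q′ i∈Q) (Q⊆Q′ j∈Q)) ∷ c′d)
          (wins c′ Sc′))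

-- Pieces may be empty, so that their number, which becomes a number of queries, is exactly `m`.
chunks : ∀ {A : Set} m K (xs : List A) → length xs ≤ m * K →
  ∃[ xss ] length xss ≡ m × All (λ ys → length ys ≤ K) xss × (∀ {x} → x List.∈ xs → Any (x List.∈_) xss)
chunks zero    K [] _ = [] , refl , [] , λ ()
chunks (suc m) K xs ∣xs∣≤K+mK =
  let xss , ∣xss∣≡m , sizes , cover = chunks m K (drop K xs)
        (≤-trans (≤-reflexive (length-drop K xs)) (m≤n+o⇒m∸n≤o (length xs) K ∣xs∣≤K+mK))
  in  take K xs ∷ xss , cong suc ∣xss∣≡m
    , ≤-trans (≤-reflexive (length-take K xs)) (m⊓n≤m K (length xs)) ∷ sizes
    , λ x∈xs → [ here , there ∘ cover ]′ (∈-++⁻ (take K xs) (subst (_ List.∈_) (sym (take++drop≡id K xs)) x∈xs))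

Together : ∀ {n} → List (Subset n) → Fin n → Fin n → Set
Together Qs i j = Any (λ Q → i ∈ Q × j ∈ Q) Qs

together⇒agree : ∀ {n} {Qs} {c d : Coloring n} {i j} → AgreeOnAll Qs c d → Together Qs i j → Agree c d i j
together⇒agree (same ∷ _) (here (i∈Q , j∈Q)) = same _ _ i∈Q j∈Q
together⇒agree (_ ∷ all)  (there tog)        = together⇒agree all tog

-- Upper bound: reconstructing the partition from the answers

two-colours-left : (w x y z : Fin 3) → x ≢ w → y ≢ w → z ≢ w → x ≢ y → y ≢ z → x ≡ z
two-colours-left = from-yes (all? λ (w : Fin 3) → all? λ (x : Fin 3) → all? λ (y : Fin 3) → all? λ (z : Fin 3) →
  ¬? (x ≟ w) →-dec ¬? (y ≟ w) →-dec ¬? (z ≟ w) →-dec ¬? (x ≟ y) →-dec ¬? (y ≟ z) →-dec (x ≟ z))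

-- Agreement is not transitive in general, since two inequalities say nothing about `i` and `l`.
-- Here the colour of `a` is excluded, so only two colours remain and two inequalities force an
-- equality, in `c` and in `d` alike.
agree-trans : ∀ {n} {c d : Coloring n} {a i j l} →
  c i ≢ c a → c j ≢ c a → c l ≢ c a → d i ≢ d a → d j ≢ d a → d l ≢ d a →
  Agree c d i j → Agree c d j l → Agree c d i l
agree-trans {c = c} {d} {a} {i} {j} {l} ci cj cl di dj dl ij jl with c i ≟ c j
... | yes ci≡cj = let di≡dj = proj₁ ij ci≡cj in
  (λ ci≡cl → trans di≡dj (proj₁ jl (trans (sym ci≡cj) ci≡cl))) ,
  (λ di≡dl → trans ci≡cj (proj₂ jl (trans (sym di≡dj) di≡dl)))
... | no ci≢cj =
  (λ ci≡cl → two-colours-left (d a) (d i) (d j) (d l) di dj dl (ci≢cj ∘ proj₂ ij)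
    (λ dj≡dl → ci≢cj (trans ci≡cl (sym (proj₂ jl dj≡dl))))) ,
  (λ di≡dl → two-colours-left (c a) (c i) (c j) (c l) ci cj cl ci≢cj
    (λ cj≡cl → ci≢cj (proj₂ ij (trans di≡dl (sym (proj₁ jl cj≡cl))))))

-- Away from the colour of a only two colours remain, so comparing every representative with b
-- decides which of the two it has.
agree-via-representatives : ∀ {n} {c d : Coloring n} (a b : Fin n) →
  (∀ i → Agree c d i a) →
  (∀ i → c i ≢ c a → c b ≢ c a × ∃[ r ] c r ≢ c a × Agree c d i r × Agree c d r b) →
  ∀ i j → Agree c d i j
agree-via-representatives {c = c} {d} a b with-a reps i j with c i ≟ c a | c j ≟ c a
... | yes ci≡ca | _ =
  (λ ci≡cj → trans (proj₁ (with-a i) ci≡ca) (sym (proj₁ (with-a j) (trans (sym ci≡cj) ci≡ca)))) ,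
  (λ di≡dj → trans ci≡ca (sym (proj₂ (with-a j) (trans (sym di≡dj) (proj₁ (with-a i) ci≡ca)))))
... | no _ | yes cj≡ca =
  (λ ci≡cj → trans (proj₁ (with-a i) (trans ci≡cj cj≡ca)) (sym (proj₁ (with-a j) cj≡ca))) ,
  (λ di≡dj → trans (proj₂ (with-a i) (trans di≡dj (proj₁ (with-a j) cj≡ca))) (sym cj≡ca))
... | no ci≢ca | no cj≢ca =
  let cb≢ca , r , cr≢ca , ir , rb = reps i ci≢ca
      _     , s , cs≢ca , js , sb = reps j cj≢ca
      dif : ∀ {x} → c x ≢ c a → d x ≢ d a
      dif = λ {x} cx≢ca dx≡da → cx≢ca (proj₂ (with-a x) dx≡da)
      ib = agree-trans {c = c} {d} {a} {i} {r} {b} ci≢ca cr≢ca cb≢ca (dif ci≢ca) (dif cr≢ca) (dif cb≢ca) ir rb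
      jb = agree-trans {c = c} {d} {a} {j} {s} {b} cj≢ca cs≢ca cb≢ca (dif cj≢ca) (dif cs≢ca) (dif cb≢ca) js sb
  in  agree-trans {c = c} {d} {a} {i} {b} {j} ci≢ca cb≢ca cj≢ca (dif ci≢ca) (dif cb≢ca) (dif cj≢ca)
        ib (agree-sym {c = c} {d} {j} {b} jb)

m≤⌈m/n⌉*n : ∀ m n → 0 < n → m ≤ ceilDiv m n * n
m≤⌈m/n⌉*n m (suc b) _ = +-cancelˡ-≤ b m _ (begin
  b + m                                            ≡⟨ +-comm b m ⟩
  m + b                                            ≡⟨ m≡m%n+[m/n]*n (m + b) (suc b) ⟩
  (m + b) % suc b + (m + b) / suc b * suc b        ≤⟨ +-monoˡ-≤ _ (≤-pred (m%n<n (m + b) (suc b))) ⟩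
  b + (m + b) / suc b * suc b                      ∎)
  where open ≤-Reasoning

⌈m/n⌉≤o : ∀ m n o → m ≤ o * n → 0 < n → ceilDiv m n ≤ o
⌈m/n⌉≤o m (suc b) o m≤o*n _ = ≤-pred (m<n*o⇒m/o<n {m + b} {suc o} {suc b} (begin-strict
  m + b                ≤⟨ +-monoˡ-≤ b m≤o*n ⟩
  o * suc b + b        <⟨ +-monoʳ-< (o * suc b) (n<1+n b) ⟩
  o * suc b + suc b    ≡⟨ +-comm (o * suc b) (suc b) ⟩
  suc o * suc b        ∎))
  where open ≤-Reasoning

-- The first round leaves one representative for each of `ceilDiv m n` blocks; by this bound they
-- fit into `ceilDiv m (n ^ 2)` groups of at most `n`.
⌈m/n⌉≤⌈m/n²⌉*n : ∀ m n → 0 < n → ceilDiv m n ≤ ceilDiv m (n ^ 2) * n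
⌈m/n⌉≤⌈m/n²⌉*n m n@(suc _) 0<n = ⌈m/n⌉≤o m n _ (begin
  m                               ≤⟨ m≤⌈m/n⌉*n m (n ^ 2) (s≤s z≤n) ⟩
  ceilDiv m (n ^ 2) * (n * (n * 1)) ≡⟨ cong (λ x → ceilDiv m (n ^ 2) * (n * x)) (*-identityʳ n) ⟩
  ceilDiv m (n ^ 2) * (n * n)     ≡⟨ *-assoc (ceilDiv m (n ^ 2)) n n ⟨
  ceilDiv m (n ^ 2) * n * n       ∎) 0<n
  where open ≤-Reasoning

-- Upper bound: the two rounds of queries

module _ {n K : ℕ} (1≤K : 1 ≤ K) (k≤n : suc K ≤ suc n) where

  private
    a : Fin (suc n)
    a = zero

    blockData : ∃[ xss ] length xss ≡ ceilDiv n K × All (λ ys → length ys ≤ K) xss ×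
      (∀ {x : Fin (suc n)} → x List.∈ tabulate suc → Any (x List.∈_) xss)
    blockData = chunks (ceilDiv n K) K (tabulate suc)
      (≤-trans (≤-reflexive (length-tabulate suc)) (m≤⌈m/n⌉*n n K 1≤K))

    blocks : List (List (Fin (suc n)))
    blocks = proj₁ blockData

    withHead : Fin (suc n) → List (List (Fin (suc n))) → List (Subset (suc n))
    withHead x = map (λ ys → fromList (x ∷ ys))

    withHead-sizes : ∀ x {xss} → All (λ ys → length ys ≤ K) xss → All (λ Q → ∣ Q ∣ ≤ suc K) (withHead x xss)
    withHead-sizes x sizes = All.map⁺ (All.map (λ {ys} ∣ys∣≤K → ≤-trans (∣fromList∣≤length (x ∷ ys)) (s≤s ∣ys∣≤K)) sizes)

    withHead-together : ∀ x {xss i j} → Any (λ ys → i List.∈ x ∷ ys × j List.∈ x ∷ ys) xss → Together (withHead x xss) i j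
    withHead-together x = Any.map⁺ ∘ Any.map λ (i∈ , j∈) → ∈-fromList⁺ i∈ , ∈-fromList⁺ j∈

    firstRound : List (Subset (suc n))
    firstRound = withHead a blocks

    representative : ∀ (c : Coloring (suc n)) xs → ∃[ r ] (∀ {i} → i List.∈ xs → c i ≢ c a → r List.∈ xs × c r ≢ c a)
    representative c xs with Any.any? (λ x → ¬? (c x ≟ c a)) xs
    ... | yes some = let r , r∈xs , cr≢ca = List.find some in r , λ _ _ → r∈xs , cr≢ca
    -- The whole block has the colour of `a`, so the specification is vacuous and `a` is a mere
    -- default.
    ... | no none  = a , λ i∈xs ci≢ca → contradiction (List.lose i∈xs ci≢ca) none

    otherColour : ∀ (c : Coloring (suc n)) → ∃[ b ] (∀ {i} → c i ≢ c a → c b ≢ c a)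
    otherColour c with any? (λ i → ¬? (c i ≟ c a))
    ... | yes (b , cb≢ca) = b , λ _ → cb≢ca
    ... | no ∄b           = a , λ {i} ci≢ca → contradiction (i , ci≢ca) ∄b

    agree-trans-on : ∀ {Qs} {c d e : Coloring (suc n)} →
      AgreeOnAll Qs c d → AgreeOnAll Qs c e → AgreeOnAll Qs d e
    agree-trans-on cd ce = All.zipWith (λ {Q} (cdQ , ceQ) → sameAnswer-trans {Q = Q} (sameAnswer-sym {Q = Q} cdQ) ceQ) (cd , ce)

  -- There are `suc n` balls, so `n` is the number of balls to be compared with `a`.
  winsC-upper : Wins GoalC (suc K) (ceilDiv n K + ceilDiv n (K ^ 2)) (Initial {suc n})
  winsC-upper = subst (λ l → Wins GoalC (suc K) (l + ceilDiv n (K ^ 2)) Initial)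
      (trans (length-map _ blocks) ∣blocks∣)
      (askAll k≤n firstRound (withHead-sizes a blockSizes) ((λ _ → 0F) , tt) afterFirst)
    where
    ∣blocks∣ = proj₁ (proj₂ blockData)
    blockSizes = proj₁ (proj₂ (proj₂ blockData))
    inBlock = proj₂ (proj₂ (proj₂ blockData))

    afterFirst : ∀ c → Initial c → Wins GoalC (suc K) (ceilDiv n (K ^ 2)) (λ d → Initial d × AgreeOnAll firstRound c d)
    -- As `c` realises the answers of the first round, it shows which balls differ in colour from
    -- `a`. This fixes `b`, the representatives and their groups before the second round.
    afterFirst c _ with otherColour c | chunks (ceilDiv n (K ^ 2)) K (map (proj₁ ∘ representative c) blocks)
        (≤-trans (≤-reflexive (trans (length-map _ blocks) ∣blocks∣)) (⌈m/n⌉≤⌈m/n²⌉*n n K 1≤K))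
    ... | b , cb≢ca | groups , ∣groups∣ , groupSizes , inGroup =
      subst (λ l → Wins GoalC (suc K) l S) (trans (+-identityʳ _) (trans (length-map _ groups) ∣groups∣))
        (askAll k≤n (withHead b groups) (withHead-sizes b groupSizes)
          (c , tt , All.universal (λ _ _ _ _ _ → id , id) firstRound)
          λ c′ _ d e ((_ , cd) , c′d) ((_ , ce) , c′e) i j →
            proj₁ (agree-via-representatives a b (withFirst (agree-trans-on cd ce))
              (reps cd (agree-trans-on cd ce) (agree-trans-on c′d c′e)) i j))
      where
      S : State (suc n)
      S d = Initial d × AgreeOnAll firstRound c d

      withFirst : ∀ {d e} → AgreeOnAll firstRound d e → ∀ i → Agree d e i a
      withFirst de zero    = (λ _ → refl) , (λ _ → refl)
      withFirst de (suc i) = together⇒agree de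
        (withHead-together a (Any.map (λ i∈ → there i∈ , here refl) (inBlock (∈-tabulate⁺ i))))

      reps : ∀ {d e} → AgreeOnAll firstRound c d → AgreeOnAll firstRound d e → AgreeOnAll (withHead b groups) d e →
        ∀ i → d i ≢ d a → d b ≢ d a × ∃[ r ] d r ≢ d a × Agree d e i r × Agree d e r b
      reps {d} {e} cd de de′ zero    da≢da = contradiction refl da≢da
      reps {d} {e} cd de de′ (suc i) di≢da =
        -- `b` and `r` were chosen by means of `c`; agreement with `a` transfers the choice to `d`.
        let ci≢ca = λ ci≡ca → di≢da (proj₁ (withFirst cd (suc i)) ci≡ca)
            keep : ∀ {x} → c x ≢ c a → d x ≢ d a
            keep = λ {x} cx≢ca dx≡da → cx≢ca (proj₂ (withFirst cd x) dx≡da)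
            xs , xs∈blocks , i∈xs = List.find (inBlock (∈-tabulate⁺ i))
            r , r-spec = representative c xs
            r∈xs , cr≢ca = r-spec i∈xs ci≢ca
        in  keep (cb≢ca ci≢ca) , r , keep cr≢ca
          , together⇒agree de (withHead-together a (List.lose xs∈blocks (there i∈xs , there r∈xs)))
          , together⇒agree de′ (withHead-together b
              (Any.map (λ r∈ → there r∈ , here refl) (inGroup (∈-map⁺ (proj₁ ∘ representative c) xs∈blocks))))

-- Lower bound: balanced colourings, with `2F` as the colour of the small class

swapColour : Fin 3 → Fin 3
swapColour 0F = 1F
swapColour 1F = 0F
swapColour 2F = 2F

swapColour-≢2 : ∀ {x} → x ≢ 2F → swapColour x ≢ 2F
swapColour-≢2 {0F} _ ()
swapColour-≢2 {1F} _ ()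
swapColour-≢2 {2F} x≢2 _ = x≢2 refl

swapColour-≢ : ∀ {x} → x ≢ 2F → swapColour x ≢ x
swapColour-≢ {0F} _ ()
swapColour-≢ {1F} _ ()
swapColour-≢ {2F} x≢2 _ = x≢2 refl

≢swapColour : ∀ x z → x ≢ 2F → z ≢ swapColour x → z ≡ x ⊎ z ≡ 2F
≢swapColour 0F 0F _ z≢ = inj₁ refl
≢swapColour 0F 1F _ z≢ = contradiction refl z≢
≢swapColour 0F 2F _ z≢ = inj₂ refl
≢swapColour 1F 0F _ z≢ = contradiction refl z≢
≢swapColour 1F 1F _ z≢ = inj₁ refl
≢swapColour 1F 2F _ z≢ = inj₂ refl
≢swapColour 2F z x≢2 _ = contradiction refl x≢2

record Balanced {n} (c : Coloring n) (m ε : ℕ) : Set where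
  field
    main : ∀ x → x ≢ 2F → count (λ i → c i ≟ x) ≡ m
    rare : count (λ i → c i ≟ 2F) ≡ ε

hasPlurality-largest : ∀ {n} (c : Coloring n) y {z} → z ≢ y →
  (∀ x → x ≢ y → count (λ i → c i ≟ x) < count (λ i → c i ≟ y)) → HasPlurality c
hasPlurality-largest c y z≢y largest
  -- The class of `y` is larger than that of `z`, hence it contains some ball `b`.
  with b , refl ← count>0⇒∃ (λ i → c i ≟ y) (≤-<-trans z≤n (largest _ z≢y)) = b , λ x x≢cb → begin-strict
  classSize c x               ≡⟨ classSize≡count c x ⟩
  count (λ i → c i ≟ x)       <⟨ largest x x≢cb ⟩
  count (λ i → c i ≟ c b)     ≡⟨ classSize≡count c (c b) ⟨
  classSize c (c b)           ∎
  where open ≤-Reasoning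

-- A large class is tied with the other large class, and the small class does not exceed them
-- because `ε ≤ m`.
balanced⇒¬hasPlurality : ∀ {n} {c : Coloring n} {m ε} → ε ≤ m → Balanced c m ε → ¬ HasPlurality c
balanced⇒¬hasPlurality {c = c} {m} {ε} ε≤m bal (b , plur) with c b in cb≡x
... | x with x ≟ 2F
...   | yes refl = <⇒≱ (plur 0F λ ()) (begin
  classSize c 2F           ≡⟨ trans (classSize≡count c 2F) (Balanced.rare bal) ⟩
  ε                        ≤⟨ ε≤m ⟩
  m                        ≡⟨ trans (classSize≡count c 0F) (Balanced.main bal 0F λ ()) ⟨
  classSize c 0F           ∎)
  where open ≤-Reasoning
...   | no x≢2 = <-irrefl
  (trans (trans (classSize≡count c (swapColour x)) (Balanced.main bal (swapColour x) (swapColour-≢2 x≢2)))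
    (sym (trans (classSize≡count c x) (Balanced.main bal x x≢2))))
  (plur (swapColour x) (swapColour-≢ x≢2))

-- Questioner's claim must be right for both colourings. A claimed plurality ball is refuted by `c`,
-- so the claim is that there is none, and it applies to `d` too.
goalP-clash : ∀ {n} {S : State n} {c d} → GoalP S → S c → S d → ¬ HasPlurality c → ¬ HasPlurality d
goalP-clash (inj₁ (b , plur)) Sc Sd ¬c = λ _ → ¬c (b , plur _ Sc)
goalP-clash (inj₂ none)       Sc Sd ¬c = none _ Sd

-- Lower bound: components of balls and the cost of joining them

module _ {n : ℕ} (c : Coloring n) where

  -- Deliberately asymmetric: a ball `s` of any colour may be attached to a root `t` of colour `2F`,
  -- but a ball of colour `2F` only to a root of its own colour.
  Compatible : Fin n → Fin n → Set
  Compatible s t = c s ≡ c t ⊎ c t ≡ 2F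

  compatible-trans : ∀ {s t u} → Compatible s t → Compatible t u → Compatible s u
  compatible-trans _            (inj₂ cu≡2)  = inj₂ cu≡2
  compatible-trans (inj₁ cs≡ct) (inj₁ ct≡cu) = inj₁ (trans cs≡ct ct≡cu)
  compatible-trans (inj₂ ct≡2)  (inj₁ ct≡cu) = inj₂ (trans (sym ct≡cu) ct≡2)

  -- f sends every ball to the root of its component; only a component with a root of colour 2 may
  -- contain balls of different colours.
  record Labelling (f : Fin n → Fin n) : Set where
    field
      idem   : ∀ x → f (f x) ≡ f x
      colour : ∀ x → Compatible x (f x)

  open Labelling

  -- Components of `g` are unions of components of `f`, and absorption never removes a root colour
  -- `2F`. Both facts are used to keep settled queries settled.
  record _⊑_ (f g : Fin n → Fin n) : Set where
    field
      keeps≡ : ∀ x y → f x ≡ f y → g x ≡ g y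
      keeps2 : ∀ x → c (f x) ≡ 2F → c (g x) ≡ 2F

  open _⊑_

  ⊑-refl : ∀ {f} → f ⊑ f
  ⊑-refl = record { keeps≡ = λ _ _ → id ; keeps2 = λ _ → id }

  ⊑-trans : ∀ {f g h} → f ⊑ g → g ⊑ h → f ⊑ h
  ⊑-trans fg gh = record
    { keeps≡ = λ x y → keeps≡ gh x y ∘ keeps≡ fg x y
    ; keeps2 = λ x → keeps2 gh x ∘ keeps2 fg x }

  -- Labellings are idempotent, so fixed points correspond to components.
  roots : (Fin n → Fin n) → ℕ
  roots f = count (λ i → f i ≟ i)

  redirect : (Fin n → Fin n) → Fin n → Fin n → Fin n → Fin n
  redirect f s t x with f x ≟ s
  ... | yes _ = t
  ... | no _  = f x

  redirect-≡ : ∀ f {s} t {x} → f x ≡ s → redirect f s t x ≡ t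
  redirect-≡ f {s} t {x} fx≡s with f x ≟ s
  ... | yes _   = refl
  ... | no fx≢s = contradiction fx≡s fx≢s

  redirect-≢ : ∀ f {s} t {x} → f x ≢ s → redirect f s t x ≡ f x
  redirect-≢ f {s} t {x} fx≢s with f x ≟ s
  ... | yes fx≡s = contradiction fx≡s fx≢s
  ... | no _     = refl

  redirect-fixes : ∀ f {s} t → f t ≡ t → redirect f s t t ≡ t
  redirect-fixes f {s} t ft≡t with f t ≟ s
  ... | yes _ = refl
  ... | no _  = ft≡t

  module _ {f : Fin n → Fin n} (lab : Labelling f) {s t : Fin n} (ft≡t : f t ≡ t) (s→t : Compatible s t) where

    redirect-labelling : Labelling (redirect f s t)
    idem redirect-labelling x with f x ≟ s
    ... | yes _   = redirect-fixes f t ft≡t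
    ... | no fx≢s = trans (redirect-≢ f t (fx≢s ∘ trans (sym (idem lab x)))) (idem lab x)
    colour redirect-labelling x with f x ≟ s
    ... | no _     = colour lab x
    ... | yes fx≡s = compatible-trans (subst (Compatible x) fx≡s (colour lab x)) s→t

    redirect-⊑ : f ⊑ redirect f s t
    keeps≡ redirect-⊑ x y fx≡fy with f x ≟ s
    ... | yes fx≡s = sym (redirect-≡ f t (trans (sym fx≡fy) fx≡s))
    ... | no fx≢s  = trans fx≡fy (sym (redirect-≢ f t (fx≢s ∘ trans fx≡fy)))
    keeps2 redirect-⊑ x cfx≡2 with f x ≟ s
    ... | no _     = cfx≡2
    ... | yes fx≡s = [ (λ cs≡ct → trans (sym cs≡ct) (trans (cong c (sym fx≡s)) cfx≡2)) , id ]′ s→t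

    redirect-roots : roots f ≤ roots (redirect f s t) + 1
    redirect-roots = begin
      roots f                                     ≤⟨ count-cover (λ i → redirect f s t i ≟ i) (_≟ s) (λ i → f i ≟ i) root ⟩
      roots (redirect f s t) + count (_≟ s)       ≡⟨ cong (roots (redirect f s t) +_) (count-≡ s) ⟩
      roots (redirect f s t) + 1                  ∎
      where
      open ≤-Reasoning
      root : ∀ i → f i ≡ i → redirect f s t i ≡ i ⊎ i ≡ s
      root i fi≡i with i ≟ s
      ... | yes i≡s = inj₂ i≡s
      ... | no i≢s  = inj₁ (trans (redirect-≢ f t (i≢s ∘ trans (sym fi≡i))) fi≡i)

  Merged : (Fin n → Fin n) → ((Fin n → Fin n) → Set) → ℕ → Set
  Merged f P t = ∃[ g ] Labelling g × f ⊑ g × P g × roots f ≤ roots g + t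

  -- One of the two roots can absorb the other. If the root of `v` has colour `2F`, it accepts
  -- anything; otherwise it has the colour of `v`, and is compatible with `u` and then with the root
  -- of `u`.
  merge : ∀ {f} → Labelling f → ∀ {u v} → Compatible v u → Merged f (λ g → g u ≡ g v) 1
  merge {f} lab {u} {v} ok = [ toU , toV ]′ orientation
    where
    orientation : Compatible (f v) (f u) ⊎ Compatible (f u) (f v)
    orientation with colour lab v
    ... | inj₂ cfv≡2  = inj₂ (inj₂ cfv≡2)
    ... | inj₁ cv≡cfv = inj₁ (compatible-trans (inj₁ (sym cv≡cfv)) (compatible-trans ok (colour lab u)))

    toU : Compatible (f v) (f u) → Merged f (λ g → g u ≡ g v) 1
    toU v→u = redirect f (f v) (f u) , redirect-labelling lab (idem lab u) v→u , redirect-⊑ lab (idem lab u) v→u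
      , trans fixed (sym (redirect-≡ f (f u) refl)) , redirect-roots lab (idem lab u) v→u
      where
      fixed : redirect f (f v) (f u) u ≡ f u
      fixed with f u ≟ f v
      ... | yes _ = refl
      ... | no _  = refl

    toV : Compatible (f u) (f v) → Merged f (λ g → g u ≡ g v) 1
    toV u→v = redirect f (f u) (f v) , redirect-labelling lab (idem lab v) u→v , redirect-⊑ lab (idem lab v) u→v
      , trans (redirect-≡ f (f v) refl) (sym fixed) , redirect-roots lab (idem lab v) u→v
      where
      fixed : redirect f (f u) (f v) v ≡ f v
      fixed with f v ≟ f u
      ... | yes _ = refl
      ... | no _  = refl

  mergeList : ∀ {f} → Labelling f → ∀ (hub : Fin n → Fin n) es →
    All (λ e → Compatible e (hub e)) es →
    Merged f (λ g → All (λ e → g (hub e) ≡ g e) es) (length es)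
  mergeList {f} lab hub [] [] = f , lab , ⊑-refl , [] , ≤-reflexive (sym (+-identityʳ _))
  mergeList {f} lab hub (e ∷ es) (ok ∷ oks) =
    let g , labg , f⊑g , ghe≡ge , rf≤rg = merge lab ok
        h , labh , g⊑h , all≡ , rg≤rh = mergeList labg hub es oks
    in  h , labh , ⊑-trans f⊑g g⊑h , keeps≡ g⊑h (hub e) e ghe≡ge ∷ all≡ , (begin
          roots f                    ≤⟨ rf≤rg ⟩
          roots g + 1                ≤⟨ +-monoˡ-≤ 1 rg≤rh ⟩
          roots h + length es + 1    ≡⟨ trans (+-assoc (roots h) _ 1) (cong (roots h +_) (+-comm (length es) 1)) ⟩
          roots h + suc (length es)  ∎)
    where open ≤-Reasoning

  -- Joining every ball of Q to its hub costs a root only for the balls that are not their own hub.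
  mergeToHubs : ∀ {f} → Labelling f → ∀ Q (hub : Fin n → Fin n) →
    (∀ i → i ∈ Q → Compatible i (hub i)) →
    ∀ {t} → t ≤ count (λ i → i ∈? Q ×-dec i ≟ hub i) →
    ∃[ g ] Labelling g × f ⊑ g × (∀ i → i ∈ Q → g (hub i) ≡ g i) × roots f + t ≤ roots g + ∣ Q ∣
  mergeToHubs {f} lab Q hub ok {t} t≤fixed =
    let g , labg , f⊑g , all≡ , rf≤rg = mergeList lab hub moved
          (All.map (λ {i} (i∈Q , _) → ok i i∈Q) (all-filter Moved? (allFin n)))
    in  g , labg , f⊑g
      , (λ i i∈Q → atHub i i∈Q all≡)
      , (begin
          roots f + t                                  ≤⟨ +-mono-≤ rf≤rg t≤fixed ⟩
          roots g + length moved + count Fixed?        ≡⟨ cong (λ l → roots g + l + count Fixed?) (length-filter-allFin Moved?) ⟩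
          roots g + count Moved? + count Fixed?        ≡⟨ +-assoc (roots g) _ _ ⟩
          roots g + (count Moved? + count Fixed?)      ≤⟨ +-monoʳ-≤ (roots g) (count-disjoint Moved? Fixed? (_∈? Q)
                                                            (λ _ → proj₁) (λ _ → proj₁) (λ _ (_ , i≢) (_ , i≡) → i≢ i≡)) ⟩
          roots g + count (_∈? Q)                      ≡⟨ cong (roots g +_) (∣p∣≡count Q) ⟨
          roots g + ∣ Q ∣                              ∎)
    where
    open ≤-Reasoning
    Moved? = λ i → i ∈? Q ×-dec ¬? (i ≟ hub i)
    Fixed? = λ i → i ∈? Q ×-dec i ≟ hub i
    moved = filter Moved? (allFin n)

    atHub : ∀ i → i ∈ Q → ∀ {g : Fin n → Fin n} → All (λ e → g (hub e) ≡ g e) moved → g (hub i) ≡ g i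
    atHub i i∈Q {g} all≡ with i ≟ hub i
    ... | yes i≡hub = cong g (sym i≡hub)
    ... | no i≢hub  = All.lookup all≡ (∈-filter⁺ Moved? (∈-allFin i) (i∈Q , i≢hub))

  -- The condition under which giving colour `2F` to a whole component with a root of large colour
  -- leaves the answer to `Q` unchanged: either `Q` meets no such component, or the component takes
  -- each colour part of `Q` entirely or not at all, and `2F` is new to `Q`.
  Settled : (Fin n → Fin n) → Subset n → Set
  Settled f Q = (∀ i → i ∈ Q → c (f i) ≡ 2F)
              ⊎ (∀ i → i ∈ Q → c i ≢ 2F) × (∀ i j → i ∈ Q → j ∈ Q → c i ≡ c j → f i ≡ f j)

  settled-⊑ : ∀ {f g Q} → f ⊑ g → Settled f Q → Settled g Q
  settled-⊑ f⊑g (inj₁ all2)        = inj₁ λ i i∈Q → keeps2 f⊑g i (all2 i i∈Q)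
  settled-⊑ f⊑g (inj₂ (no2 , same)) = inj₂ (no2 , λ i j i∈Q j∈Q ci≡cj → keeps≡ f⊑g i j (same i j i∈Q j∈Q ci≡cj))

  Split : Subset n → Set
  Split Q = (∀ i → i ∈ Q → c i ≢ 2F) × (∀ x → x ≢ 2F → ∃[ i ] i ∈ Q × c i ≡ x)

  -- The value is arbitrary when Q has no ball of colour x.
  hubOf : ∀ Q → ∃[ e ] e ∈ Q → (x : Fin 3) → ∃[ h ] (∀ {i} → i ∈ Q → c i ≡ x → h ∈ Q × c h ≡ x)
  hubOf Q (e , e∈Q) x with any? (λ i → i ∈? Q ×-dec c i ≟ x)
  ... | yes (h , h∈Q , ch≡x) = h , λ _ _ → h∈Q , ch≡x
  ... | no ∄h                = e , λ i∈Q ci≡x → contradiction (_ , i∈Q , ci≡x) ∄h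

  -- The inequality says that at most `∣ Q ∣` minus `t` components are lost, written without
  -- truncated subtraction.
  SettledAt : (Fin n → Fin n) → Subset n → ℕ → Set
  SettledAt f Q t = ∃[ g ] Labelling g × f ⊑ g × Settled g Q × roots f + t ≤ roots g + ∣ Q ∣

  module _ {f : Fin n → Fin n} (lab : Labelling f) (Q : Subset n) (nonempty : ∃[ e ] e ∈ Q) where

    private
      hub : Fin n → Fin n
      hub i = proj₁ (hubOf Q nonempty (c i))

      hub-spec : ∀ {i} → i ∈ Q → hub i ∈ Q × c (hub i) ≡ c i
      hub-spec i∈Q = proj₂ (hubOf Q nonempty (c _)) i∈Q refl

      hub-fixed : ∀ {i} → i ∈ Q → hub i ≡ hub (hub i)
      hub-fixed i∈Q = cong (λ x → proj₁ (hubOf Q nonempty x)) (sym (proj₂ (hub-spec i∈Q)))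

      settleByColour : (∀ i → i ∈ Q → c i ≢ 2F) → ∀ {t} → t ≤ count (λ i → i ∈? Q ×-dec i ≟ hub i) → SettledAt f Q t
      settleByColour no2 t≤ =
        let g , labg , f⊑g , g≡ , rf≤rg = mergeToHubs lab Q hub (λ i i∈Q → inj₁ (sym (proj₂ (hub-spec i∈Q)))) t≤
        in  g , labg , f⊑g
          , inj₂ (no2 , λ i j i∈Q j∈Q ci≡cj →
              trans (sym (g≡ i i∈Q)) (trans (cong (λ x → g (proj₁ (hubOf Q nonempty x))) ci≡cj) (g≡ j j∈Q)))
          , rf≤rg

    -- A query with a ball `z` of colour `2F` is joined to `z` entirely; any other query is joined
    -- colour by colour. Either way at least one ball is its own hub and costs nothing.
    settle : SettledAt f Q 1
    settle with any? (λ i → i ∈? Q ×-dec c i ≟ 2F)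
    ... | no ∄2 = settleByColour (λ i i∈Q ci≡2 → ∄2 (i , i∈Q , ci≡2))
      (∃⇒count>0 (λ i → i ∈? Q ×-dec i ≟ hub i) (proj₁ (hub-spec (proj₂ nonempty)) , hub-fixed (proj₂ nonempty)))
    ... | yes (z , z∈Q , cz≡2) =
      let g , labg , f⊑g , g≡ , rf≤rg = mergeToHubs lab Q (λ _ → z) (λ _ _ → inj₂ cz≡2)
            (∃⇒count>0 (λ i → i ∈? Q ×-dec i ≟ z) (z∈Q , refl))
      in  g , labg , f⊑g
        -- The root above `z` has colour `2F`: a root either shares the colour of its ball or has
        -- colour `2F`, and here both mean the same.
        , inj₁ (λ i i∈Q → subst (λ l → c l ≡ 2F) (g≡ i i∈Q) ([ (λ cz≡cgz → trans (sym cz≡cgz) cz≡2) , id ]′ (colour labg z)))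
        , rf≤rg

    -- Both large colours occur in `Q`, and their hubs are distinct because their colours are; so
    -- two balls cost nothing.
    settleSplit : Split Q → SettledAt f Q 2
    settleSplit (no2 , both) =
      let i , i∈Q , ci≡0 = both 0F λ ()
          j , j∈Q , cj≡1 = both 1F λ ()
          hi∈Q , chi≡ci = hub-spec i∈Q
          hj∈Q , chj≡cj = hub-spec j∈Q
      in  settleByColour no2 (begin
            2                                        ≡⟨ cong₂ _+_ (count-≡ (hub i)) (count-≡ (hub j)) ⟨
            count (_≟ hub i) + count (_≟ hub j)      ≤⟨ count-disjoint (_≟ hub i) (_≟ hub j) (λ l → l ∈? Q ×-dec l ≟ hub l)
                                                          (λ { _ refl → hi∈Q , hub-fixed i∈Q })
                                                          (λ { _ refl → hj∈Q , hub-fixed j∈Q })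
                                                          (λ l l≡hi l≡hj → contradiction
                                                            (trans (sym ci≡0) (trans (sym chi≡ci) (trans (cong c (trans (sym l≡hi) l≡hj)) (trans chj≡cj cj≡1))))
                                                            λ ()) ⟩
            count (λ l → l ∈? Q ×-dec l ≟ hub l)     ∎)
      where open ≤-Reasoning

  settleList : ∀ {k t f} → Labelling f → ∀ Qs →
    All (λ Q → ∣ Q ∣ ≡ k × (∀ g → Labelling g → SettledAt g Q t)) Qs →
    ∃[ g ] Labelling g × f ⊑ g × All (Settled g) Qs × roots f + length Qs * t ≤ roots g + length Qs * k
  settleList {f = f} lab [] [] = f , lab , ⊑-refl , [] , ≤-refl
  settleList {k} {t} {f} lab (Q ∷ Qs) ((∣Q∣≡k , step) ∷ steps) =
    let g , labg , f⊑g , settledQ , rf≤rg = step f lab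
        h , labh , g⊑h , settledQs , rg≤rh = settleList labg Qs steps
    in  h , labh , ⊑-trans f⊑g g⊑h , settled-⊑ g⊑h settledQ ∷ settledQs , (begin
          roots f + (t + length Qs * t)             ≡⟨ +-assoc (roots f) t _ ⟨
          roots f + t + length Qs * t               ≤⟨ +-monoˡ-≤ _ rf≤rg ⟩
          roots g + ∣ Q ∣ + length Qs * t           ≡⟨ cong (λ l → roots g + l + length Qs * t) ∣Q∣≡k ⟩
          roots g + k + length Qs * t               ≡⟨ swap (roots g) k _ ⟩
          roots g + length Qs * t + k               ≤⟨ +-monoˡ-≤ k rg≤rh ⟩
          roots h + length Qs * k + k               ≡⟨ swap′ (roots h) _ k ⟩
          roots h + (k + length Qs * k)             ∎)
    where
    open ≤-Reasoning
    swap : ∀ x y z → x + y + z ≡ x + z + y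
    swap = solve-∀
    swap′ : ∀ x y z → x + y + z ≡ x + (z + y)
    swap′ = solve-∀

  id-labelling : Labelling id
  id-labelling = record { idem = λ _ → refl ; colour = λ _ → inj₁ refl }

  -- Lower bound: recolouring a component creates a plurality

  recolour : (Fin n → Fin n) → Fin n → Coloring n
  recolour f r i with f i ≟ r
  ... | yes _ = 2F
  ... | no _  = c i

  module _ {f : Fin n → Fin n} (lab : Labelling f) {r : Fin n} (cr≢2 : c r ≢ 2F) where

    blob-colour : ∀ {i} → f i ≡ r → c i ≡ c r
    blob-colour {i} refl = [ id , (λ cfi≡2 → contradiction cfi≡2 cr≢2) ]′ (colour lab i)

    -- If all roots above `Q` have colour `2F`, then `Q` avoids the component of `r`. Otherwise a
    -- colour part of `Q` meeting that component lies inside it, and its new colour `2F` occurs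
    -- nowhere else in `Q`.
    recolour-agrees : ∀ {Q} → Settled f Q → SameAnswer Q c (recolour f r)
    recolour-agrees (inj₁ all2) i j i∈Q j∈Q with f i ≟ r | f j ≟ r
    ... | yes refl | _        = contradiction (all2 i i∈Q) cr≢2
    ... | no _     | yes refl = contradiction (all2 j j∈Q) cr≢2
    ... | no _     | no _     = id , id
    recolour-agrees (inj₂ (no2 , same)) i j i∈Q j∈Q with f i ≟ r | f j ≟ r
    ... | no _     | no _     = id , id
    ... | yes fi≡r | yes fj≡r = (λ _ → refl) , (λ _ → trans (blob-colour fi≡r) (sym (blob-colour fj≡r)))
    ... | yes fi≡r | no fj≢r  = (λ ci≡cj → contradiction (trans (sym (same i j i∈Q j∈Q ci≡cj)) fi≡r) fj≢r)
                              , (λ 2≡cj → contradiction (sym 2≡cj) (no2 j j∈Q))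
    ... | no fi≢r  | yes fj≡r = (λ ci≡cj → contradiction (trans (same i j i∈Q j∈Q ci≡cj) fj≡r) fi≢r)
                              , (λ ci≡2 → contradiction ci≡2 (no2 i i∈Q))

  -- The other large class keeps its `m` balls, and the class of `x` loses `r`. The small class
  -- grows to the size of the component plus `ε`, but at least `1 + ε` further roots of colour `x`
  -- lie outside the component, so it stays below `m`.
  recolour-plurality : ∀ {f m ε} → Labelling f → Balanced c m ε → ∀ {x r} → x ≢ 2F → f r ≡ r → c r ≡ x →
    2 + ε ≤ count (λ i → f i ≟ i ×-dec c i ≟ x) → HasPlurality (recolour f r)
  recolour-plurality {f} {m} {ε} lab bal {r = r} x≢2 fr≡r refl many =
    hasPlurality-largest (recolour f r) y (swapColour-≢ x≢2 ∘ sym) λ z z≢y →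
      <-≤-trans ([ (λ { refl → old-class }) , (λ { refl → rare-class }) ]′ (≢swapColour x z x≢2 z≢y)) other-class
    where
    open ≤-Reasoning
    d = recolour f r
    x = c r
    y = swapColour x

    other-class : m ≤ count (λ i → d i ≟ y)
    other-class = begin
      m                       ≡⟨ Balanced.main bal y (swapColour-≢2 x≢2) ⟨
      count (λ i → c i ≟ y)   ≤⟨ count-mono (λ i → c i ≟ y) (λ i → d i ≟ y) untouched ⟩
      count (λ i → d i ≟ y)   ∎
      where
      untouched : ∀ i → c i ≡ y → d i ≡ y
      untouched i ci≡y with f i ≟ r
      ... | yes fi≡r = contradiction (trans (sym ci≡y) (blob-colour lab x≢2 fi≡r)) (swapColour-≢ x≢2)
      ... | no _     = ci≡y

    old-class : count (λ i → d i ≟ x) < m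
    old-class = begin
      suc (count (λ i → d i ≟ x))              ≡⟨ +-comm 1 _ ⟩
      count (λ i → d i ≟ x) + 1                ≡⟨ cong (count (λ i → d i ≟ x) +_) (count-≡ r) ⟨
      count (λ i → d i ≟ x) + count (_≟ r)     ≤⟨ count-disjoint (λ i → d i ≟ x) (_≟ r) (λ i → c i ≟ x) ⊆old (λ { _ refl → refl }) r-gone ⟩
      count (λ i → c i ≟ x)                    ≡⟨ Balanced.main bal x x≢2 ⟩
      m                                        ∎
      where
      ⊆old : ∀ i → d i ≡ x → c i ≡ x
      ⊆old i di≡x with f i ≟ r
      ... | yes _ = contradiction (sym di≡x) x≢2
      ... | no _  = di≡x
      r-gone : ∀ i → d i ≡ x → i ≢ r
      r-gone i di≡x refl with f r ≟ r
      ... | yes _   = x≢2 (sym di≡x)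
      ... | no fr≢r = fr≢r fr≡r

    Blob? = λ i → f i ≟ r
    Root? = λ i → f i ≟ i ×-dec c i ≟ x
    OtherRoot? = λ i → Root? i ×-dec ¬? (i ≟ r)

    enough : 1 + ε ≤ count OtherRoot?
    enough = +-cancelʳ-≤ 1 _ _ (begin
      1 + ε + 1                            ≡⟨ +-comm (1 + ε) 1 ⟩
      2 + ε                                ≤⟨ many ⟩
      count Root?                          ≤⟨ count-cover OtherRoot? (_≟ r) Root? split ⟩
      count OtherRoot? + count (_≟ r)      ≡⟨ cong (count OtherRoot? +_) (count-≡ r) ⟩
      count OtherRoot? + 1                 ∎)
      where
      split : ∀ i → f i ≡ i × c i ≡ x → (f i ≡ i × c i ≡ x) × i ≢ r ⊎ i ≡ r
      split i root with i ≟ r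
      ... | yes i≡r = inj₂ i≡r
      ... | no i≢r  = inj₁ (root , i≢r)

    rare-class : count (λ i → d i ≟ 2F) < m
    rare-class = begin-strict
      count (λ i → d i ≟ 2F)                      ≤⟨ count-cover Blob? (λ i → c i ≟ 2F) (λ i → d i ≟ 2F) split ⟩
      count Blob? + count (λ i → c i ≟ 2F)        ≡⟨ cong (count Blob? +_) (Balanced.rare bal) ⟩
      count Blob? + ε                             <⟨ +-monoʳ-< (count Blob?) enough ⟩
      count Blob? + count OtherRoot?              ≤⟨ count-disjoint Blob? OtherRoot? (λ i → c i ≟ x)
                                                       (λ _ → blob-colour lab x≢2) (λ _ → proj₂ ∘ proj₁)
                                                       (λ i fi≡r ((fi≡i , _) , i≢r) → i≢r (trans (sym fi≡i) fi≡r)) ⟩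
      count (λ i → c i ≟ x)                       ≡⟨ Balanced.main bal x x≢2 ⟩
      m                                           ∎
      where
      split : ∀ i → d i ≡ 2F → f i ≡ r ⊎ c i ≡ 2F
      split i di≡2 with f i ≟ r
      ... | yes fi≡r = inj₁ fi≡r
      ... | no _     = inj₂ di≡2

  three-classes : ∀ {P : Fin n → Set} (P? : ∀ i → Dec (P i)) →
    count P? ≤ count (λ i → P? i ×-dec c i ≟ 0F) + (count (λ i → P? i ×-dec c i ≟ 1F) + count (λ i → P? i ×-dec c i ≟ 2F))
  three-classes {P} P? = ≤-trans
    (count-cover (λ i → P? i ×-dec c i ≟ 0F) (λ i → (P? i ×-dec c i ≟ 1F) ⊎-dec (P? i ×-dec c i ≟ 2F)) P? by-colour)
    (+-monoʳ-≤ _ (count-cover (λ i → P? i ×-dec c i ≟ 1F) (λ i → P? i ×-dec c i ≟ 2F)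
      (λ i → (P? i ×-dec c i ≟ 1F) ⊎-dec (P? i ×-dec c i ≟ 2F)) λ _ → id))
    where
    by-colour : ∀ i → P i → P i × c i ≡ 0F ⊎ P i × c i ≡ 1F ⊎ P i × c i ≡ 2F
    by-colour i p with c i
    ... | 0F = inj₁ (p , refl)
    ... | 1F = inj₂ (inj₁ (p , refl))
    ... | 2F = inj₂ (inj₂ (p , refl))

  -- More than `1 + ε` roots of one large colour would let a recoloured component contradict the
  -- goal. With at most `ε` roots of colour `2F` this sums to `2 + 3 * ε`.
  roots-bound : ∀ {f m ε} → Labelling f → ε ≤ m → Balanced c m ε → ∀ {Ms Ss} →
    All (Settled f) Ms → All (Settled f) Ss →
    GoalP (λ d → AgreeOnAll Ms c d × AgreeOnAll Ss c d) → roots f ≤ 2 + 3 * ε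
  roots-bound {f} {m} {ε} lab ε≤m bal {Ms} {Ss} settledM settledS goal = begin
    roots f                                        ≤⟨ three-classes (λ i → f i ≟ i) ⟩
    count (rootOf? 0F) + (count (rootOf? 1F) + count (rootOf? 2F))
                                                   ≤⟨ +-mono-≤ (few 0F λ ()) (+-mono-≤ (few 1F λ ())
                                                        (≤-trans (count-mono (rootOf? 2F) (λ i → c i ≟ 2F) λ _ → proj₂) (≤-reflexive (Balanced.rare bal)))) ⟩
    1 + ε + (1 + ε + ε)                            ≡⟨ arith ε ⟩
    2 + 3 * ε                                      ∎
    where
    open ≤-Reasoning
    arith : ∀ x → 1 + x + (1 + x + x) ≡ 2 + 3 * x
    arith = solve-∀
    rootOf? = λ x i → f i ≟ i ×-dec c i ≟ x
    few : ∀ x → x ≢ 2F → count (rootOf? x) ≤ 1 + ε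
    few x x≢2 with 2 + ε ≤? count (rootOf? x)
    ... | no ≰      = ≤-pred (≰⇒> ≰)
    ... | yes many with r , fr≡r , refl ← count>0⇒∃ (rootOf? x) (≤-trans (s≤s z≤n) many) =
      contradiction (recolour-plurality lab bal x≢2 fr≡r refl many)
        (goalP-clash goal
          (All.universal (λ _ _ _ _ _ → id , id) Ms , All.universal (λ _ _ _ _ _ → id , id) Ss)
          (All.map (λ {Q} → recolour-agrees lab x≢2 {Q}) settledM , All.map (λ {Q} → recolour-agrees lab x≢2 {Q}) settledS)
          (balanced⇒¬hasPlurality ε≤m bal))

nonempty-of-size : ∀ {n k} (Q : Subset n) → ∣ Q ∣ ≡ suc k → ∃[ e ] e ∈ Q
nonempty-of-size Q ∣Q∣≡1+k = count>0⇒∃ (_∈? Q)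
  (≤-trans (s≤s z≤n) (≤-reflexive (trans (sym ∣Q∣≡1+k) (∣p∣≡count Q))))

-- Start from `n` singletons. Settling an ordinary query costs at most `K` components, a split one
-- at most `K` minus one, and at most `2 + 3 * ε` components may remain.
connectivity-bound : ∀ {n} (c : Coloring n) {m ε K} → ε ≤ m → Balanced c m ε → ∀ Ms Ss →
  All (λ Q → ∣ Q ∣ ≡ suc K) Ms → All (λ Q → ∣ Q ∣ ≡ suc K) Ss → All (Split c) Ss →
  GoalP (λ d → AgreeOnAll Ms c d × AgreeOnAll Ss c d) →
  n + length Ss ≤ (length Ms + length Ss) * K + (2 + 3 * ε)
connectivity-bound {n} c {m} {ε} {K} ε≤m bal Ms Ss sizeM sizeS splitS goal =
  let f , labf , _ , settledM , n≤rf = settleList c (id-labelling c) Ms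
        (All.map (λ {Q} ∣Q∣≡k → ∣Q∣≡k , λ _ lab → settle c lab Q (nonempty-of-size Q ∣Q∣≡k)) sizeM)
      g , labg , f⊑g , settledS , rf≤rg = settleList c labf Ss
        (All.zipWith (λ {Q} (∣Q∣≡k , split) → ∣Q∣≡k , λ _ lab → settleSplit c lab Q (nonempty-of-size Q ∣Q∣≡k) split) (sizeS , splitS))
      rg≤ = roots-bound c labg ε≤m bal (All.map (λ {Q} → settled-⊑ c {Q = Q} f⊑g) settledM) settledS goal
  -- Adding `a + s` on both sides turns the costs into query sizes `suc K`, with savings of 1 and 2
  -- on the left.
  in  +-cancelʳ-≤ (a + s) _ _ (begin
        n + s + (a + s)                               ≡⟨ arith₁ n a s ⟩
        n + a * 1 + s * 2                             ≡⟨ cong (λ l → l + a * 1 + s * 2) (count-all (λ i → i ≟ i) (λ _ → refl)) ⟨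
        roots c id + a * 1 + s * 2                    ≤⟨ +-monoˡ-≤ _ n≤rf ⟩
        roots c f + a * suc K + s * 2                 ≡⟨ arith₂ (roots c f) (a * suc K) (s * 2) ⟩
        roots c f + s * 2 + a * suc K                 ≤⟨ +-monoˡ-≤ _ rf≤rg ⟩
        roots c g + s * suc K + a * suc K             ≤⟨ +-monoˡ-≤ _ (+-monoˡ-≤ _ rg≤) ⟩
        2 + 3 * ε + s * suc K + a * suc K             ≡⟨ arith₃ (2 + 3 * ε) s a K ⟩
        (a + s) * K + (2 + 3 * ε) + (a + s)           ∎)
  where
  open ≤-Reasoning
  a = length Ms
  s = length Ss
  arith₁ : ∀ n a s → n + s + (a + s) ≡ n + a * 1 + s * 2
  arith₁ = solve-∀
  arith₂ : ∀ x y z → x + y + z ≡ x + z + y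
  arith₂ = solve-∀
  arith₃ : ∀ e s a K → e + s * suc K + a * suc K ≡ (a + s) * K + e + (a + s)
  arith₃ = solve-∀

-- Lower bound: changing colours outside the queried balls

transpose-first : ∀ {n} (u v : Fin n) → transpose u v ⟨$⟩ʳ u ≡ v
transpose-first u v with u ≟ u
... | yes _  = refl
... | no u≢u = contradiction refl u≢u

transpose-other : ∀ {n} {u v i : Fin n} → i ≢ u → i ≢ v → transpose u v ⟨$⟩ʳ i ≡ i
transpose-other {u = u} {v} {i} i≢u i≢v with i ≟ u
... | yes i≡u = contradiction i≡u i≢u
... | no _ with i ≟ v
...   | yes i≡v = contradiction i≡v i≢v
...   | no _    = refl

sameAnswer-≗ : ∀ {n} {c d : Coloring n} {Q} → (∀ i → i ∈ Q → d i ≡ c i) → SameAnswer Q c d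
sameAnswer-≗ d≗c i j i∈Q j∈Q =
  (λ ci≡cj → trans (d≗c i i∈Q) (trans ci≡cj (sym (d≗c j j∈Q)))) ,
  (λ di≡dj → trans (sym (d≗c i i∈Q)) (trans di≡dj (d≗c j j∈Q)))

split-≗ : ∀ {n} {c d : Coloring n} {Q} → (∀ i → i ∈ Q → d i ≡ c i) → Split c Q → Split d Q
split-≗ d≗c (no2 , both) =
  (λ i i∈Q di≡2 → no2 i i∈Q (trans (sym (d≗c i i∈Q)) di≡2)) ,
  (λ x x≢2 → let i , i∈Q , ci≡x = both x x≢2 in i , i∈Q , trans (d≗c i i∈Q) ci≡x)

balanced-size : ∀ {n} {c : Coloring n} {m ε} → Balanced c m ε → n ≤ m + (m + ε)
balanced-size {n} {c} {m} {ε} bal = begin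
  n                                ≡⟨ count-all (λ i → i ≟ i) (λ _ → refl) ⟨
  count {n} (λ i → i ≟ i)          ≤⟨ three-classes c (λ i → i ≟ i) ⟩
  classes 0F + (classes 1F + classes 2F)
                                   ≤⟨ +-mono-≤ (bound 0F) (+-mono-≤ (bound 1F) (bound 2F)) ⟩
  count (λ i → c i ≟ 0F) + (count (λ i → c i ≟ 1F) + count (λ i → c i ≟ 2F))
                                   ≡⟨ cong₂ _+_ (Balanced.main bal 0F λ ()) (cong₂ _+_ (Balanced.main bal 1F λ ()) (Balanced.rare bal)) ⟩
  m + (m + ε)                      ∎
  where
  open ≤-Reasoning
  classes : Fin 3 → ℕ
  classes x = count (λ i → i ≟ i ×-dec c i ≟ x)
  bound : ∀ x → classes x ≤ count (λ i → c i ≟ x)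
  bound x = count-mono (λ i → i ≟ i ×-dec c i ≟ x) (λ i → c i ≟ x) λ _ → proj₂

newColour : (x : Fin 3) → ∃[ y ] y ≢ 2F × y ≢ x
newColour 0F = 1F , (λ ()) , λ ()
newColour 1F = 0F , (λ ()) , λ ()
newColour 2F = 0F , (λ ()) , λ ()

paint : ∀ {n} → Coloring n → Fin n → Fin 3 → Coloring n
paint c u y i with i ≟ u
... | yes _ = y
... | no _  = c i

paint-other : ∀ {n} (c : Coloring n) {u} y {i} → i ≢ u → paint c u y i ≡ c i
paint-other c {u} y {i} i≢u with i ≟ u
... | yes i≡u = contradiction i≡u i≢u
... | no _    = refl

-- The class of `y` grows to `suc m`, while no other class gains a ball and none exceeded `m`
-- before.
paint-plurality : ∀ {n} {c : Coloring n} {m ε} → ε ≤ m → Balanced c m ε →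
  ∀ u {y} → y ≢ 2F → y ≢ c u → HasPlurality (paint c u y)
paint-plurality {c = c} {m} {ε} ε≤m bal u {y} y≢2 y≢cu =
  hasPlurality-largest d y (y≢2 ∘ sym) λ x x≢y → ≤-trans (s≤s (others x x≢y)) grown
  where
  open ≤-Reasoning
  d = paint c u y

  class≤m : ∀ x → count (λ i → c i ≟ x) ≤ m
  class≤m x with x ≟ 2F
  ... | yes refl = ≤-trans (≤-reflexive (Balanced.rare bal)) ε≤m
  ... | no x≢2   = ≤-reflexive (Balanced.main bal x x≢2)

  others : ∀ x → x ≢ y → count (λ i → d i ≟ x) ≤ m
  others x x≢y = ≤-trans (count-mono (λ i → d i ≟ x) (λ i → c i ≟ x) shrinks) (class≤m x)
    where
    shrinks : ∀ i → d i ≡ x → c i ≡ x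
    shrinks i di≡x with i ≟ u
    ... | yes _ = contradiction (sym di≡x) x≢y
    ... | no _  = di≡x

  grown : suc m ≤ count (λ i → d i ≟ y)
  grown = begin
    1 + m                                      ≡⟨ cong₂ _+_ (count-≡ u) (Balanced.main bal y y≢2) ⟨
    count (_≟ u) + count (λ i → c i ≟ y)       ≤⟨ count-disjoint (_≟ u) (λ i → c i ≟ y) (λ i → d i ≟ y) painted kept
                                                    (λ { _ refl cu≡y → y≢cu (sym cu≡y) }) ⟩
    count (λ i → d i ≟ y)                      ∎
    where
    painted : ∀ i → i ≡ u → d i ≡ y
    painted i i≡u with i ≟ u
    ... | yes _   = refl
    ... | no i≢u  = contradiction i≡u i≢u
    kept : ∀ i → c i ≡ y → d i ≡ y
    kept i ci≡y with i ≟ u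
    ... | yes _ = refl
    ... | no _  = ci≡y

-- Lower bound: the strategy of Adversary

module Adversary {n m ε K : ℕ} (ε≤1 : ε ≤ 1) (ε≤m : ε ≤ m) (1≤K : 1 ≤ K) where

  -- Ss lists the split queries asked so far, Ms the other ones.
  record Position (c : Coloring n) (Ms Ss : List (Subset n)) : Set where
    field
      balanced : Balanced c m ε
      sizeM    : All (λ Q → ∣ Q ∣ ≡ suc K) Ms
      sizeS    : All (λ Q → ∣ Q ∣ ≡ suc K) Ss
      splitS   : All (Split c) Ss

  open Position

  -- The adversary may still permute the colours of the balls outside T.
  record Flexible (c : Coloring n) (Ms Ss : List (Subset n)) : Set where
    field
      T   : Subset n
      M⊆T : All (λ Q → ∀ i → i ∈ Q → i ∈ T) Ms
      S⊆T : All (λ Q → ∀ i → i ∈ Q → i ∈ T) Ss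
      few : ∀ x → x ≢ 2F → count (λ i → i ∈? T ×-dec c i ≟ x) ≤ length Ss * K
      no2 : ∀ i → i ∈ T → c i ≢ 2F

  open Flexible

  -- The desired lower bound on the number of split queries; once reached, Adversary stops
  -- exchanging colours. The last term allows for one query of size `suc K` that cannot avoid the
  -- ball of colour `2F` when `ε` is 1.
  Exhausted : List (Subset n) → Set
  Exhausted Ss = n ≤ 2 * (length Ss * K) + ε * suc K

  Phase : Coloring n → List (Subset n) → List (Subset n) → Set
  Phase c Ms Ss = Flexible c Ms Ss ⊎ Exhausted Ss

  Reply : Coloring n → List (Subset n) → List (Subset n) → Subset n → Set
  Reply c Ms Ss Q = ∃[ d ] AgreeOnAll Ms c d × AgreeOnAll Ss c d ×
    (Position d (Q ∷ Ms) Ss × Phase d (Q ∷ Ms) Ss ⊎ Position d Ms (Q ∷ Ss) × Phase d Ms (Q ∷ Ss))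

  agree-refl : ∀ {c : Coloring n} Qs → AgreeOnAll Qs c c
  agree-refl = All.universal (λ _ _ _ _ _ → id , id)

  module _ {c : Coloring n} {Ms Ss : List (Subset n)} (pos : Position c Ms Ss) where

    ordinary : ∀ {Q} → ∣ Q ∣ ≡ suc K → Phase c (Q ∷ Ms) Ss → Reply c Ms Ss Q
    ordinary ∣Q∣ phase = c , agree-refl Ms , agree-refl Ss , inj₁
      (record { balanced = balanced pos ; sizeM = ∣Q∣ ∷ sizeM pos ; sizeS = sizeS pos ; splitS = splitS pos } , phase)

    module _ (flex : Flexible c Ms Ss) where

      touched≤ : ∣ T flex ∣ ≤ 2 * (length Ss * K)
      touched≤ = begin
        ∣ T flex ∣                                 ≡⟨ ∣p∣≡count (T flex) ⟩
        count (_∈? T flex)                         ≤⟨ three-classes c (_∈? T flex) ⟩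
        touched 0F + (touched 1F + touched 2F)     ≤⟨ +-mono-≤ (few flex 0F λ ()) (+-mono-≤ (few flex 1F λ ()) (≤-reflexive
                                                        (count-none (λ i → i ∈? T flex ×-dec c i ≟ 2F) (λ i (i∈T , ci≡2) → no2 flex i i∈T ci≡2)))) ⟩
        length Ss * K + (length Ss * K + 0)        ∎
        where
        open ≤-Reasoning
        touched : Fin 3 → ℕ
        touched x = count (λ i → i ∈? T flex ×-dec c i ≟ x)

      -- `Q` contains a ball of each large colour, hence at most `K` balls of either one. So the
      -- bound on touched balls grows by `K`, which the longer list `Q ∷ Ss` permits.
      split-step : ∀ {Q} → ∣ Q ∣ ≡ suc K → Split c Q → Reply c Ms Ss Q
      split-step {Q} ∣Q∣ split = c , agree-refl Ms , agree-refl Ss , inj₂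
        ( record { balanced = balanced pos ; sizeM = sizeM pos ; sizeS = ∣Q∣ ∷ sizeS pos ; splitS = split ∷ splitS pos }
        , inj₁ record
          { T   = T flex ∪ Q
          ; M⊆T = All.map (λ ⊆T i → x∈p∪q⁺ ∘ inj₁ ∘ ⊆T i) (M⊆T flex)
          ; S⊆T = (λ _ → x∈p∪q⁺ ∘ inj₂) ∷ All.map (λ ⊆T i → x∈p∪q⁺ ∘ inj₁ ∘ ⊆T i) (S⊆T flex)
          ; few = few′
          ; no2 = λ i i∈ → [ no2 flex i , proj₁ split i ]′ (x∈p∪q⁻ (T flex) Q i∈) })
        where
        open ≤-Reasoning
        Q≤K : ∀ x → x ≢ 2F → count (λ i → i ∈? Q ×-dec c i ≟ x) ≤ K
        Q≤K x x≢2 =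
          let j , j∈Q , cj≡ = proj₂ split (swapColour x) (swapColour-≢2 x≢2)
          in  +-cancelʳ-≤ 1 _ _ (begin
            count (λ i → i ∈? Q ×-dec c i ≟ x) + 1               ≡⟨ cong (count (λ i → i ∈? Q ×-dec c i ≟ x) +_) (count-≡ j) ⟨
            count (λ i → i ∈? Q ×-dec c i ≟ x) + count (_≟ j)    ≤⟨ count-disjoint (λ i → i ∈? Q ×-dec c i ≟ x) (_≟ j) (_∈? Q)
                                                                      (λ _ → proj₁) (λ { _ refl → j∈Q })
                                                                      (λ { _ (_ , cj≡x) refl → swapColour-≢ x≢2 (trans (sym cj≡) cj≡x) }) ⟩
            count (_∈? Q)                                        ≡⟨ trans (sym (∣p∣≡count Q)) (trans ∣Q∣ (+-comm 1 K)) ⟩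
            K + 1                                                ∎)
        few′ : ∀ x → x ≢ 2F → count (λ i → i ∈? (T flex ∪ Q) ×-dec c i ≟ x) ≤ length (Q ∷ Ss) * K
        few′ x x≢2 = begin
          count (λ i → i ∈? (T flex ∪ Q) ×-dec c i ≟ x)
            ≤⟨ count-cover (λ i → i ∈? Q ×-dec c i ≟ x) (λ i → i ∈? T flex ×-dec c i ≟ x) (λ i → i ∈? (T flex ∪ Q) ×-dec c i ≟ x)
                 (λ _ (i∈ , ci≡x) → [ (λ i∈T → inj₂ (i∈T , ci≡x)) , (λ i∈Q → inj₁ (i∈Q , ci≡x)) ]′ (x∈p∪q⁻ (T flex) Q i∈)) ⟩
          count (λ i → i ∈? Q ×-dec c i ≟ x) + count (λ i → i ∈? T flex ×-dec c i ≟ x)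
            ≤⟨ +-mono-≤ (Q≤K x x≢2) (few flex x x≢2) ⟩
          K + length Ss * K ∎

      -- Exchanging the colours of two untouched balls alters neither the class sizes nor the
      -- colours in former queries, so the reply may be built from `d` in place of `c`.
      exchange : ∀ {u v} → u ∉ T flex → v ∉ T flex → ∀ {Q} →
        let d = λ i → c (transpose u v ⟨$⟩ʳ i) in
        (Position d Ms Ss → Flexible d Ms Ss → Reply d Ms Ss Q) → Reply c Ms Ss Q
      exchange {u} {v} u∉T v∉T {Q} next =
        let e , de , de′ , result = next pos′ flex′
        in  e , combine (All.map (λ ⊆T → sameAnswer-≗ (λ i → same i ∘ ⊆T i)) (M⊆T flex)) de
              , combine (All.map (λ ⊆T → sameAnswer-≗ (λ i → same i ∘ ⊆T i)) (S⊆T flex)) de′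
              , result
        where
        d : Coloring n
        d i = c (transpose u v ⟨$⟩ʳ i)

        combine : ∀ {Qs e} → AgreeOnAll Qs c d → AgreeOnAll Qs d e → AgreeOnAll Qs c e
        combine cd de = All.zipWith (λ {Q} (cdQ , deQ) → sameAnswer-trans {Q = Q} cdQ deQ) (cd , de)

        same : ∀ i → i ∈ T flex → d i ≡ c i
        same i i∈T = cong c (transpose-other (λ { refl → u∉T i∈T }) (λ { refl → v∉T i∈T }))

        pos′ : Position d Ms Ss
        pos′ = record
          { balanced = record
            { main = λ x x≢2 → trans (count-transpose (λ i → c i ≟ x) u v) (Balanced.main (balanced pos) x x≢2)
            ; rare = trans (count-transpose (λ i → c i ≟ 2F) u v) (Balanced.rare (balanced pos)) }
          ; sizeM    = sizeM pos
          ; sizeS    = sizeS pos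
          ; splitS   = All.zipWith (λ (⊆T , split) → split-≗ (λ i → same i ∘ ⊆T i) split) (S⊆T flex , splitS pos) }

        flex′ : Flexible d Ms Ss
        flex′ = record
          { T   = T flex
          ; M⊆T = M⊆T flex
          ; S⊆T = S⊆T flex
          ; few = λ x x≢2 → ≤-trans
              (count-mono (λ i → i ∈? T flex ×-dec d i ≟ x) (λ i → i ∈? T flex ×-dec c i ≟ x)
                (λ i (i∈T , di≡x) → i∈T , trans (sym (same i i∈T)) di≡x))
              (few flex x x≢2)
          ; no2 = λ i i∈T di≡2 → no2 flex i i∈T (trans (sym (same i i∈T)) di≡2) }

      -- At most `length Ss * K` balls of a large colour are touched. If that is the whole class, it
      -- bounds `m`, and thereby the other large class too.
      class-exhausted : ∀ {y} → y ≢ 2F → (∀ v → c v ≡ y → v ∈ T flex) → Exhausted Ss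
      class-exhausted {y} y≢2 inT = begin
        n                                    ≤⟨ balanced-size (balanced pos) ⟩
        m + (m + ε)                          ≤⟨ +-mono-≤ m≤ (+-mono-≤ m≤ ε≤) ⟩
        l + (l + ε * suc K)                  ≡⟨ arith l (ε * suc K) ⟩
        2 * l + ε * suc K                    ∎
        where
        open ≤-Reasoning
        l = length Ss * K
        arith : ∀ x y → x + (x + y) ≡ 2 * x + y
        arith = solve-∀
        ε≤ : ε ≤ ε * suc K
        ε≤ = m≤m*n ε (suc K)
        m≤ : m ≤ l
        m≤ = begin
          m                                          ≡⟨ Balanced.main (balanced pos) y y≢2 ⟨
          count (λ i → c i ≟ y)                      ≤⟨ count-mono (λ i → c i ≟ y) (λ i → i ∈? T flex ×-dec c i ≟ y) (λ i ci≡y → inT i ci≡y , ci≡y) ⟩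
          count (λ i → i ∈? T flex ×-dec c i ≟ y)    ≤⟨ few flex y y≢2 ⟩
          l                                          ∎

  -- The use of `1 ≤ K` by Adversary: when one ball of a monochromatic query changes colour, another
  -- ball still shows the old one.
  two-in-query : ∀ {Q : Subset n} → ∣ Q ∣ ≡ suc K → ∀ u → ∃[ e ] e ∈ Q × e ≢ u
  two-in-query {Q} ∣Q∣ u = count>0⇒∃ (λ i → i ∈? Q ×-dec ¬? (i ≟ u)) (+-cancelʳ-≤ 1 _ _ (begin
    2                                                         ≤⟨ s≤s 1≤K ⟩
    suc K                                                     ≡⟨ trans (sym ∣Q∣) (∣p∣≡count Q) ⟩
    count (_∈? Q)                                             ≤⟨ count-cover (λ i → i ∈? Q ×-dec ¬? (i ≟ u)) (_≟ u) (_∈? Q) cover ⟩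
    count (λ i → i ∈? Q ×-dec ¬? (i ≟ u)) + count (_≟ u)      ≡⟨ cong (count (λ i → i ∈? Q ×-dec ¬? (i ≟ u)) +_) (count-≡ u) ⟩
    count (λ i → i ∈? Q ×-dec ¬? (i ≟ u)) + 1                 ∎))
    where
    open ≤-Reasoning
    cover : ∀ i → i ∈ Q → i ∈ Q × i ≢ u ⊎ i ≡ u
    cover i i∈Q with i ≟ u
    ... | yes i≡u = inj₂ i≡u
    ... | no i≢u  = inj₁ (i∈Q , i≢u)

  split-or-monochromatic : ∀ (c : Coloring n) Q → (∀ i → i ∈ Q → c i ≢ 2F) →
    Split c Q ⊎ ∃[ x ] x ≢ 2F × (∀ i → i ∈ Q → c i ≡ x)
  split-or-monochromatic c Q no2Q
    with any? (λ i → i ∈? Q ×-dec c i ≟ 0F) | any? (λ i → i ∈? Q ×-dec c i ≟ 1F)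
  ... | yes has0 | yes has1 = inj₁ (no2Q , λ
    { 0F _ → has0 ; 1F _ → has1 ; 2F 2≢2 → contradiction refl 2≢2 })
  ... | no ∄0 | _ = inj₂ (1F , (λ ()) , only1)
    where
    only1 : ∀ i → i ∈ Q → c i ≡ 1F
    only1 i i∈Q with c i in ci
    ... | 0F = contradiction (i , i∈Q , ci) ∄0
    ... | 1F = refl
    ... | 2F = contradiction ci (no2Q i i∈Q)
  ... | yes _ | no ∄1 = inj₂ (0F , (λ ()) , only0)
    where
    only0 : ∀ i → i ∈ Q → c i ≡ 0F
    only0 i i∈Q with c i in ci
    ... | 0F = refl
    ... | 1F = contradiction (i , i∈Q , ci) ∄1
    ... | 2F = contradiction ci (no2Q i i∈Q)

  -- A monochromatic query with an untouched ball is made split by exchanging that ball with an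
  -- untouched one of the other large colour; if there is none, that colour is exhausted. A
  -- monochromatic query inside `T` is filed under `Ms` and leaves `T` as it is.
  reply-no2 : ∀ {c Ms Ss} → Position c Ms Ss → Flexible c Ms Ss → ∀ {Q} → ∣ Q ∣ ≡ suc K →
    (∀ i → i ∈ Q → c i ≢ 2F) → Reply c Ms Ss Q
  reply-no2 {c} {Ms} {Ss} pos flex {Q} ∣Q∣ no2Q with split-or-monochromatic c Q no2Q
  ... | inj₁ split = split-step pos flex ∣Q∣ split
  ... | inj₂ (x , x≢2 , mono)
    with any? (λ u → u ∈? Q ×-dec ¬? (u ∈? T flex)) | any? (λ v → ¬? (v ∈? T flex) ×-dec c v ≟ swapColour x)
  ...   | no Q⊆T | _ = ordinary pos ∣Q∣ (inj₁ record
    { T = T flex ; M⊆T = Q⊆ ∷ M⊆T flex ; S⊆T = S⊆T flex ; few = few flex ; no2 = no2 flex })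
    where
    Q⊆ : ∀ i → i ∈ Q → i ∈ T flex
    Q⊆ i i∈Q with i ∈? T flex
    ... | yes i∈T = i∈T
    ... | no i∉T  = contradiction (i , i∈Q , i∉T) Q⊆T
  ...   | yes _ | no none = ordinary pos ∣Q∣ (inj₂ (class-exhausted pos flex (swapColour-≢2 x≢2) inT))
    where
    inT : ∀ v → c v ≡ swapColour x → v ∈ T flex
    inT v cv≡ with v ∈? T flex
    ... | yes v∈T = v∈T
    ... | no v∉T  = contradiction (v , v∉T , cv≡) none
  ...   | yes (u , u∈Q , u∉T) | yes (v , v∉T , cv≡y) =
    exchange pos flex u∉T v∉T λ pos′ flex′ → split-step pos′ flex′ ∣Q∣ (no2′ , both)
    where
    y = swapColour x
    d : Coloring n
    d i = c (transpose u v ⟨$⟩ʳ i)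

    du≡y : d u ≡ y
    du≡y = trans (cong c (transpose-first u v)) cv≡y

    rest : ∀ i → i ∈ Q → i ≢ u → d i ≡ x
    rest i i∈Q i≢u = trans
      (cong c (transpose-other i≢u (λ { refl → swapColour-≢ x≢2 (trans (sym cv≡y) (mono v i∈Q)) })))
      (mono i i∈Q)

    no2′ : ∀ i → i ∈ Q → d i ≢ 2F
    no2′ i i∈Q di≡2 =
      [ (λ { refl → swapColour-≢2 x≢2 (trans (sym du≡y) di≡2) })
      , (λ i≢u → x≢2 (trans (sym (rest i i∈Q i≢u)) di≡2)) ]′ (toSum (i ≟ u))

    both : ∀ z → z ≢ 2F → ∃[ i ] i ∈ Q × d i ≡ z
    both z z≢2 with z ≟ y
    ... | yes z≡y = u , u∈Q , trans du≡y (sym z≡y)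
    ... | no z≢y  =
      let e , e∈Q , e≢u = two-in-query ∣Q∣ u
      in  e , e∈Q , trans (rest e e∈Q e≢u) (sym ([ id , (λ z≡2 → contradiction z≡2 z≢2) ]′ (≢swapColour x z x≢2 z≢y)))

  rare-unique : ∀ {c : Coloring n} → Balanced c m ε → ∀ {i j} → c i ≡ 2F → c j ≡ 2F → i ≡ j
  rare-unique {c} bal {i} {j} ci≡2 cj≡2 with i ≟ j
  ... | yes i≡j = i≡j
  ... | no i≢j  = contradiction (begin
    2                                    ≡⟨ cong₂ _+_ (count-≡ i) (count-≡ j) ⟨
    count (_≟ i) + count (_≟ j)          ≤⟨ count-disjoint (_≟ i) (_≟ j) (λ l → c l ≟ 2F) (λ { _ refl → ci≡2 }) (λ { _ refl → cj≡2 })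
                                              (λ { _ refl i≡j → i≢j i≡j }) ⟩
    count (λ l → c l ≟ 2F)               ≡⟨ Balanced.rare bal ⟩
    ε                                    ≤⟨ ε≤1 ⟩
    1                                    ∎) λ { (s≤s ()) }
    where open ≤-Reasoning

  -- The ball `z` of colour `2F` is untouched, so its colour can be moved to an untouched ball
  -- outside `Q`. If no such ball exists, `T` and `Q` cover everything, which gives `Exhausted`.
  reply : ∀ {c Ms Ss} → Position c Ms Ss → Phase c Ms Ss → ∀ Q → ∣ Q ∣ ≡ suc K → Reply c Ms Ss Q
  -- From now on every query is filed under `Ms`, whether split or not; the cost bound of `settle`
  -- holds for both kinds.
  reply pos (inj₂ exhausted) Q ∣Q∣ = ordinary pos ∣Q∣ (inj₂ exhausted)
  reply {c} {Ms} {Ss} pos (inj₁ flex) Q ∣Q∣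
    with any? (λ i → i ∈? Q ×-dec c i ≟ 2F)
  ... | no ∄2 = reply-no2 pos flex ∣Q∣ λ i i∈Q ci≡2 → ∄2 (i , i∈Q , ci≡2)
  ... | yes (z , z∈Q , cz≡2)
    with any? (λ w → ¬? (w ∈? T flex) ×-dec ¬? (w ∈? Q))
  ...   | yes (w , w∉T , w∉Q) =
    exchange pos flex (λ z∈T → no2 flex z z∈T cz≡2) w∉T λ pos′ flex′ → reply-no2 pos′ flex′ ∣Q∣ no2′
    where
    no2′ : ∀ i → i ∈ Q → c (transpose z w ⟨$⟩ʳ i) ≢ 2F
    no2′ i i∈Q di≡2 =
      [ (λ { refl → w∉Q (subst (_∈ Q)
          (rare-unique (balanced pos) cz≡2 (trans (cong c (sym (transpose-first z w))) di≡2)) z∈Q) })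
      , (λ i≢z → i≢z (rare-unique (balanced pos)
          (trans (cong c (sym (transpose-other i≢z λ { refl → w∉Q i∈Q }))) di≡2) cz≡2)) ]′ (toSum (i ≟ z))
  ...   | no none = ordinary pos ∣Q∣ (inj₂ (begin
    n                                        ≡⟨ count-all (λ i → i ≟ i) (λ _ → refl) ⟨
    count {n} (λ i → i ≟ i)                  ≤⟨ count-cover (_∈? T flex) (_∈? Q) (λ i → i ≟ i) (λ i _ → cover i) ⟩
    count (_∈? T flex) + count (_∈? Q)       ≡⟨ cong₂ _+_ (sym (∣p∣≡count (T flex))) (trans (sym (∣p∣≡count Q)) ∣Q∣) ⟩
    ∣ T flex ∣ + suc K                       ≤⟨ +-mono-≤ (touched≤ pos flex) (≤-trans (≤-reflexive (sym (*-identityˡ (suc K)))) (*-monoˡ-≤ (suc K) 1≤ε)) ⟩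
    2 * (length Ss * K) + ε * suc K          ∎))
    where
    open ≤-Reasoning
    cover : ∀ i → i ∈ T flex ⊎ i ∈ Q
    cover i with i ∈? T flex | i ∈? Q
    ... | yes i∈T | _       = inj₁ i∈T
    ... | no _    | yes i∈Q = inj₂ i∈Q
    ... | no i∉T  | no i∉Q  = contradiction (i , i∉T , i∉Q) none
    1≤ε : 1 ≤ ε
    1≤ε = subst (1 ≤_) (Balanced.rare (balanced pos)) (∃⇒count>0 (λ i → c i ≟ 2F) cz≡2)

  -- While some ball is untouched, painting it yields a plurality without changing any answer, so
  -- the goal cannot have been reached. Hence every ball is touched.
  finished : ∀ {c Ms Ss} → Position c Ms Ss → Phase c Ms Ss →
    GoalP (λ d → AgreeOnAll Ms c d × AgreeOnAll Ss c d) → Exhausted Ss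
  finished pos (inj₂ exhausted) goal = exhausted
  finished {c} {Ms} {Ss} pos (inj₁ flex) goal with any? (λ u → ¬? (u ∈? T flex))
  ... | yes (u , u∉T) =
    let y , y≢2 , y≢cu = newColour (c u)
        same : ∀ i → i ∈ T flex → paint c u y i ≡ c i
        same = λ i i∈T → paint-other c y λ { refl → u∉T i∈T }
    in  contradiction (paint-plurality ε≤m (balanced pos) u y≢2 y≢cu)
          (goalP-clash goal (agree-refl Ms , agree-refl Ss)
            ( All.map (λ ⊆T → sameAnswer-≗ (λ i → same i ∘ ⊆T i)) (M⊆T flex)
            , All.map (λ ⊆T → sameAnswer-≗ (λ i → same i ∘ ⊆T i)) (S⊆T flex))
            (balanced⇒¬hasPlurality ε≤m (balanced pos)))
  ... | no allTouched = begin
    n                                        ≡⟨ count-all (_∈? T flex) inT ⟨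
    count (_∈? T flex)                       ≡⟨ ∣p∣≡count (T flex) ⟨
    ∣ T flex ∣                               ≤⟨ touched≤ pos flex ⟩
    2 * (length Ss * K)                      ≤⟨ m≤m+n _ _ ⟩
    2 * (length Ss * K) + ε * suc K          ∎
    where
    open ≤-Reasoning
    inT : ∀ i → i ∈ T flex
    inT i with i ∈? T flex
    ... | yes i∈T = i∈T
    ... | no i∉T  = contradiction (i , i∉T) allTouched

  -- Lower bound: playing the game to its end

  Outcome : ℕ → Set
  Outcome l = ∃[ a ] ∃[ s ] a + s ≤ l × n + s ≤ (a + s) * K + (2 + 3 * ε) × n ≤ 2 * (s * K) + ε * suc K

  goalP-antitone : ∀ {S S′ : State n} → (∀ d → S′ d → S d) → GoalP S → GoalP S′
  goalP-antitone S′⊆S (inj₁ (b , plur)) = inj₁ (b , λ d S′d → plur d (S′⊆S d S′d))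
  goalP-antitone S′⊆S (inj₂ none)       = inj₂ λ d S′d → none d (S′⊆S d S′d)

  stop : ∀ {q c Ms Ss} {S : State n} → Position c Ms Ss → Phase c Ms Ss →
    (∀ d → AgreeOnAll Ms c d × AgreeOnAll Ss c d → S d) → GoalP S → Outcome (q + (length Ms + length Ss))
  stop {q} {c} {Ms} {Ss} pos phase consistent goal =
    let goal′ = goalP-antitone consistent goal
    in  length Ms , length Ss , m≤n+m _ q
      , connectivity-bound c ε≤m (balanced pos) Ms Ss (sizeM pos) (sizeS pos) (splitS pos) goal′
      , finished pos phase goal′

  -- Induction on the remaining queries. The state enters only through the inclusion `consistent`,
  -- which can be passed on when Adversary replaces `c` by another colouring with the same answers.
  play : ∀ q {c Ms Ss} {S : State n} → Position c Ms Ss → Phase c Ms Ss →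
    (∀ d → AgreeOnAll Ms c d × AgreeOnAll Ss c d → S d) →
    Wins GoalP (suc K) q S → Outcome (q + (length Ms + length Ss))
  play zero    pos phase consistent goal        = stop {0} pos phase consistent goal
  play (suc q) pos phase consistent (inj₁ goal) = stop {suc q} pos phase consistent goal
  play (suc q) {c} {Ms} {Ss} {S} pos phase consistent (inj₂ (Q , ∣Q∣ , next))
    with d , cdM , cdS , result ← reply pos phase Q ∣Q∣ = continue result
    where
    back : ∀ {Qs e} → AgreeOnAll Qs c d → AgreeOnAll Qs d e → AgreeOnAll Qs c e
    back cd de = All.zipWith (λ {Q} (cdQ , deQ) → sameAnswer-trans {Q = Q} cdQ deQ) (cd , de)

    -- The answer is the one induced by `d`, which is in `S` because it repeats all former answers.
    wins = next d (consistent d (cdM , cdS))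

    continue : Position d (Q ∷ Ms) Ss × Phase d (Q ∷ Ms) Ss ⊎ Position d Ms (Q ∷ Ss) × Phase d Ms (Q ∷ Ss) →
      Outcome (suc q + (length Ms + length Ss))
    continue (inj₁ (pos′ , phase′)) = subst Outcome (+-suc q _)
      (play q pos′ phase′ (λ { e (sameQ ∷ deM , deS) → consistent e (back cdM deM , back cdS deS) , sameQ }) wins)
    continue (inj₂ (pos′ , phase′)) = subst Outcome (trans (cong (q +_) (+-suc (length Ms) _)) (+-suc q _))
      (play q pos′ phase′ (λ { e (deM , sameQ ∷ deS) → consistent e (back cdM deM , back cdS deS) , sameQ }) wins)

  lower-bound : ∀ {c : Coloring n} → Balanced c m ε → ∀ q → Wins GoalP (suc K) q (Initial {n}) → Outcome q
  lower-bound {c} bal q wins = subst Outcome (+-identityʳ q)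
    (play q {c} {[]} {[]}
      (record { balanced = bal ; sizeM = [] ; sizeS = [] ; splitS = [] })
      (inj₁ record
        { T   = ⊥
        ; M⊆T = []
        ; S⊆T = []
        ; few = λ x _ → ≤-reflexive (count-none (λ i → i ∈? ⊥ ×-dec c i ≟ x) (λ i (i∈⊥ , _) → ∉⊥ i∈⊥))
        ; no2 = λ i i∈⊥ → contradiction i∈⊥ ∉⊥ })
      (λ _ _ → tt) wins)

-- The initial colouring and the final inequalities

alternating : ∀ n → Coloring n
alternating 1             zero          = 2F
alternating (suc (suc n)) zero          = 0F
alternating (suc (suc n)) (suc zero)    = 1F
alternating (suc (suc n)) (suc (suc i)) = alternating n i

alternating-balanced : ∀ n → Balanced (alternating n) ⌊ n /2⌋ (n % 2)
alternating-balanced zero = record { main = λ _ _ → refl ; rare = refl }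
alternating-balanced (suc zero) = record
  { main = λ { 0F _ → refl ; 1F _ → refl ; 2F 2≢2 → contradiction refl 2≢2 } ; rare = refl }
alternating-balanced (suc (suc n)) = record
  { main = λ { 0F x≢2 → cong suc (Balanced.main (alternating-balanced n) 0F x≢2)
             ; 1F x≢2 → cong suc (Balanced.main (alternating-balanced n) 1F x≢2)
             ; 2F 2≢2 → contradiction refl 2≢2 }
  ; rare = Balanced.rare (alternating-balanced n) }

-- A lower bound is stated as an inequality for every `q` with which Questioner wins. Denominators
-- are cleared by the factor `2 * (k ∸ 1) ^ 2`; in the odd case the subtracted 5 becomes
-- `10 * (k ∸ 1)` on the right.
theorem1 : (n k : ℕ) → 2 ≤ k → k ≤ n →
    ((q : ℕ) → Wins GoalC k q (Initial {n}) → Wins GoalP k q (Initial {n}))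
    × Wins GoalC k (ceilDiv (n ∸ 1) (k ∸ 1) + ceilDiv (n ∸ 1) ((k ∸ 1) ^ 2)) (Initial {n})
    × (n % 2 ≡ 0 → (q : ℕ) → Wins GoalP k q (Initial {n}) →
    2 * (n ∸ 2) * (k ∸ 1) + n ≤ 2 * q * (k ∸ 1) ^ 2)
    × (n % 2 ≡ 1 → (q : ℕ) → Wins GoalP k q (Initial {n}) →
    2 * n * (k ∸ 1) + (n ∸ k) ≤ 2 * q * (k ∸ 1) ^ 2 + 10 * (k ∸ 1))
theorem1 (suc (suc n)) (suc K) (s≤s 1≤K) k≤n =
    (λ q → winsC⇒winsP q ((λ _ → 0F) , tt))
  , winsC-upper 1≤K k≤n
  , even
  , odd
  where
  open ≤-Reasoning
  N = suc (suc n)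

  balanced : ∀ {ε} → N % 2 ≡ ε → Balanced (alternating N) ⌊ N /2⌋ ε
  balanced refl = alternating-balanced N

  -- Here `n` is `N` minus two. Multiplying `n + s ≤ q * K` by `2 * K` produces the term
  -- `2 * (s * K)`, which is at least `N`; this eliminates `s`.
  even : N % 2 ≡ 0 → ∀ q → Wins GoalP (suc K) q (Initial {N}) → 2 * n * K + N ≤ 2 * q * K ^ 2
  even N%2≡0 q wins =
    let a , s , a+s≤q , connected , exhausted = Adversary.lower-bound z≤n z≤n 1≤K (balanced N%2≡0) q wins
        n+s≤ : n + s ≤ q * K
        n+s≤ = +-cancelʳ-≤ 2 _ _ (begin
          n + s + 2                  ≡⟨ +-comm (n + s) 2 ⟩
          N + s                      ≤⟨ connected ⟩
          (a + s) * K + 2            ≤⟨ +-monoˡ-≤ 2 (*-monoˡ-≤ K a+s≤q) ⟩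
          q * K + 2                  ∎)
    in  begin
      2 * n * K + N                  ≤⟨ +-monoʳ-≤ (2 * n * K) exhausted ⟩
      2 * n * K + (2 * (s * K) + 0)  ≡⟨ arith₁ n s K ⟩
      2 * K * (n + s)                ≤⟨ *-monoʳ-≤ (2 * K) n+s≤ ⟩
      2 * K * (q * K)                ≡⟨ arith₂ q K ⟩
      2 * q * K ^ 2                  ∎
    where
    arith₁ : ∀ n s K → 2 * n * K + (2 * (s * K) + 0) ≡ 2 * K * (n + s)
    arith₁ = solve-∀
    arith₂ : ∀ q K → 2 * K * (q * K) ≡ 2 * q * (K * (K * 1))
    arith₂ = solve-∀

  odd : N % 2 ≡ 1 → ∀ q → Wins GoalP (suc K) q (Initial {N}) →
    2 * N * K + (N ∸ suc K) ≤ 2 * q * K ^ 2 + 10 * K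
  odd N%2≡1 q wins =
    -- As `N` is at least 2, the large classes are nonempty, which is `ε ≤ m` for `ε` equal to 1.
    let a , s , a+s≤q , connected , exhausted = Adversary.lower-bound ≤-refl (s≤s z≤n) 1≤K (balanced N%2≡1) q wins
        N∸k≤ : N ∸ suc K ≤ 2 * (s * K)
        N∸k≤ = m≤n+o⇒m∸n≤o N (suc K) (begin
          N                                ≤⟨ exhausted ⟩
          2 * (s * K) + 1 * suc K          ≡⟨ trans (cong (2 * (s * K) +_) (*-identityˡ (suc K))) (+-comm (2 * (s * K)) (suc K)) ⟩
          suc K + 2 * (s * K)              ∎)
    in  begin
      2 * N * K + (N ∸ suc K)        ≤⟨ +-monoʳ-≤ (2 * N * K) N∸k≤ ⟩
      2 * N * K + 2 * (s * K)        ≡⟨ arith₁ N s K ⟩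
      -- The 5 is `2 + 3 * ε` with `ε` equal to 1.
      2 * K * (N + s)                ≤⟨ *-monoʳ-≤ (2 * K) (≤-trans connected (+-monoˡ-≤ 5 (*-monoˡ-≤ K a+s≤q))) ⟩
      2 * K * (q * K + 5)            ≡⟨ arith₂ q K ⟩
      2 * q * K ^ 2 + 10 * K         ∎
    where
    arith₁ : ∀ n s K → 2 * n * K + 2 * (s * K) ≡ 2 * K * (n + s)
    arith₁ = solve-∀
    arith₂ : ∀ q K → 2 * K * (q * K + 5) ≡ 2 * q * (K * (K * 1)) + 10 * K
    arith₂ = solve-∀
theorem1 (suc zero) (suc (suc _)) _ (s≤s ())
theorem1 (suc zero) 1 (s≤s ()) _
theorem1 zero k 2≤k k≤0 = contradiction (≤-trans 2≤k k≤0) λ ()
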